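{- Let $G=(V,E,w)$ be a finite connected graph with $|V|=n\ge2$ and weights $w:E\to\mathbb{R}_{>0}$. Let $T\in\mathcal T_{\mathrm{conn}}^{\mathrm{bin}}(G)$ satisfy $$F(T)\le\alpha\operatorname{OPT}_{\mathrm{free}}(G,w)$$ for some $\alpha\ge1$. Suppose that a function $\Phi:[1,n-1]\to\mathbb R_{\ge0}$ satisfies $$\mu_T\bigl(\{S:\rho_T(S)>t\}\bigr)\le\Phi(t)\qquad\text{for every }t\in[1,n-1].$$ Then $$\operatorname{OPT}_{\mathrm{card}}(G,w)\le\alpha\left(1+\int_1^{n-1}\Phi(t)\,dt\right)\operatorname{OPT}_{\mathrm{free}}(G,w).$$
   Context: $d_G$ is the shortest-path metric of $(V,E)$ with every edge of length $1$ (weights are not lengths); $\operatorname{diam}_{d_G}(S)=\max_{a,b\in S}d_G(a,b)$. A rooted binary hierarchy $T$ on $V$ is a rooted tree whose leaves are the vertices of $V$ and whose internal nodes have exactly two children; each node is identified with the set of leaves below it (a cluster); $C_T(x,y)$ is the cluster of the lowest common ancestor of $x,y$. $\mathcal T_{\mathrm{conn}}^{\mathrm{bin}}(G)$ is the set of rooted binary hierarchies on $V$ all of whose clusters induce connected subgraphs of $G$. $\mathcal I(T)$ is the family of internal (non-leaf) clusters. For $S\in\mathcal I(T)$ with children $S^0,S^1$: $b_T(S)$ is the total weight of edges with one endpoint in $S^0$ and the other in $S^1$; $\Delta_T(S)=\operatorname{diam}_{d_G}(S)$; $a_T(S)=\Delta_T(S)b_T(S)$; $\rho_T(S)=(|S|-1)/\Delta_T(S)$.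 $F(T)=\sum_{xy\in E}w_{xy}\operatorname{diam}_{d_G}(C_T(x,y))>0$, and $\mu_T(S)=a_T(S)/F(T)$ for $S\in\mathcal I(T)$, which defines a probability measure on $\mathcal I(T)$; the set $\{S:\rho_T(S)>t\}$ consists of clusters $S\in\mathcal I(T)$. $\operatorname{OPT}_{\mathrm{free}}(G,w)$ is the minimum of $\sum_{xy\in E}w_{xy}u(x,y)$ over all ultrametrics $u$ on $V$ (metrics with $u(x,y)\le\max\{u(x,z),u(z,y)\}$ for all $x,y,z$) with $u\ge d_G$ on all pairs. For a rooted binary hierarchy $H$ on $V$ put $h_H(x,x)=0$ and $h_H(x,y)=|C_H(x,y)|-1$ for $x\ne y$; $\operatorname{OPT}_{\mathrm{card}}(G,w)$ is the minimum of $\sum_{xy\in E}w_{xy}h_H(x,y)$ over all rooted binary hierarchies $H$ on $V$ with $h_H\ge d_G$ on all pairs. -}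

module Defs where

open import Level using (Level; 0ℓ; suc)
open import Algebra.Core using (Op₁; Op₂)
open import Algebra.Bundles using (CommutativeRing)
open import Algebra.Structures using (IsCommutativeRing)
import Algebra.Construct.NaturalChoice.Max as NaturalMax
import Algebra.Definitions.RawMonoid as RawMonoidOps
open import Data.Bool.Base using (if_then_else_)
open import Data.Fin.Base using (Fin)
import Data.Fin.Base as Fin
import Data.Fin.Properties as Fin
open import Data.List.Base using (List; []; _∷_; [_]; _++_; map; foldr; filter; length; cartesianProduct; allFin; upTo)
open import Data.List.Extrema.Nat using (max)
open import Data.List.Relation.Binary.Permutation.Propositional using (_↭_)
open import Data.List.Relation.Unary.All using (All)
open import Data.Nat.Base as ℕ using (ℕ; _∸_)
import Data.Nat.Properties as ℕ
open import Data.Product.Base using (Σ; ∃; _×_; _,_; proj₁; proj₂)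
open import Data.Sum.Base using (_⊎_)
open import Function.Bundles using (Func)
open import Function.Metric.Structures using (IsGeneralMetric)
open import Relation.Binary.Bundles using (Setoid; DecTotalOrder; StrictTotalOrder)
open import Relation.Binary.Core using (Rel)
import Relation.Binary.Construct.On as On
open import Relation.Binary.Definitions using (Symmetric; Irreflexive; _Respects_) renaming (Decidable to Decidable₂)
import Relation.Binary.Properties.DecTotalOrder as DecTotalOrderProperties
open import Relation.Binary.PropositionalEquality using (_≡_; refl)
open import Relation.Binary.Structures using (IsDecTotalOrder)
open import Relation.Nullary using (¬_; Dec; yes; no; does)
open import Relation.Nullary.Decidable using (map′; _×-dec_; _⊎-dec_)
open import Relation.Unary using (Pred; Decidable; Satisfiable; _∈_; _⊆_; _∩_; ∁)

private
  variable
    a ℓ : Level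
    n : ℕ

module Bounds {A : Set} (_≤_ : Rel A 0ℓ) where

  IsUpperBound IsLowerBound IsLUB IsGLB IsMinimum : Pred A ℓ → A → Set ℓ
  IsUpperBound P b = ∀ {x} → P x → x ≤ b
  IsLowerBound P b = ∀ {x} → P x → b ≤ x
  IsLUB P s = IsUpperBound P s × (∀ b → IsUpperBound P b → s ≤ b)
  IsGLB P s = IsLowerBound P s × (∀ b → IsLowerBound P b → b ≤ s)
  IsMinimum P m = P m × IsLowerBound P m

-- The real numbers, characterised up to isomorphism as the complete ordered
-- field (in the classical sense: the order is decidable and every inhabited,
-- bounded predicate has a supremum).  The value of 0# ⁻¹ is unspecified.

record CompleteOrderedField : Set₁ where
  infix  8 _⁻¹
  infix  8 -_
  infixl 7 _*_
  infixl 6 _+_ _-_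
  infix  4 _≈_ _≤_

  field
    ℝ       : Set
    _≈_ _≤_ : Rel ℝ 0ℓ
    _+_ _*_ : Op₂ ℝ
    -_ _⁻¹  : Op₁ ℝ
    0# 1#   : ℝ
    isCommutativeRing : IsCommutativeRing _≈_ _+_ _*_ -_ 0# 1#
    0≉1               : ¬ 0# ≈ 1#
    ⁻¹-cong           : ∀ {x y} → x ≈ y → x ⁻¹ ≈ y ⁻¹
    ⁻¹-inverseˡ       : ∀ {x} → ¬ x ≈ 0# → x ⁻¹ * x ≈ 1#
    isDecTotalOrder   : IsDecTotalOrder _≈_ _≤_
    +-monoʳ-≤         : ∀ x {y z} → y ≤ z → x + y ≤ x + z
    *-nonNegative     : ∀ {x y} → 0# ≤ x → 0# ≤ y → 0# ≤ x * y

  open Bounds _≤_ public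

  field
    supremum : (P : Pred ℝ 0ℓ) → Satisfiable P → ∃ (IsUpperBound P) → ∃ (IsLUB P)

  commutativeRing : CommutativeRing 0ℓ 0ℓ
  commutativeRing = record { isCommutativeRing = isCommutativeRing }

  decTotalOrder : DecTotalOrder 0ℓ 0ℓ 0ℓ
  decTotalOrder = record { isDecTotalOrder = isDecTotalOrder }

  open DecTotalOrder decTotalOrder public using (totalOrder; _≤?_)
  open DecTotalOrderProperties decTotalOrder public using (_<_; <-strictTotalOrder)
  open StrictTotalOrder <-strictTotalOrder public using (_<?_)
  open NaturalMax totalOrder public using () renaming (_⊔_ to maxℝ)

  ℝ-setoid : Setoid 0ℓ 0ℓ
  ℝ-setoid = CommutativeRing.setoid commutativeRing

  _-_ : Op₂ ℝ
  x - y = x + (- y)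

  fromℕ : ℕ → ℝ
  fromℕ k = k · 1#
    where open RawMonoidOps (CommutativeRing.+-rawMonoid commutativeRing) renaming (_×_ to infixr 8 _·_)

  ∑ : {A : Set a} → List A → (A → ℝ) → ℝ
  ∑ xs f = foldr (λ x s → f x + s) 0# xs

  Interval : ℝ → ℝ → Pred ℝ 0ℓ
  Interval a b t = a ≤ t × t ≤ b

  [_,_]ℝ : ℝ → ℝ → Setoid 0ℓ 0ℓ
  [ a , b ]ℝ = On.setoid {B = Σ ℝ (Interval a b)} ℝ-setoid proj₁

  ℝ≥0 : Setoid 0ℓ 0ℓ
  ℝ≥0 = On.setoid {B = Σ ℝ (0# ≤_)} ℝ-setoid proj₁

module LebesgueIntegral (R : CompleteOrderedField) where
  open CompleteOrderedField R

  record OpenCover (A : Pred ℝ 0ℓ) : Set where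
    field
      left right : ℕ → ℝ
      left≤right : ∀ k → left k ≤ right k
      covers     : ∀ {x} → x ∈ A → ∃ λ k → left k < x × x < right k

    IsPartialLength : Pred ℝ 0ℓ
    IsPartialLength s = ∃ λ N → s ≈ ∑ (upTo N) (λ k → right k - left k)

    IsTotalLength : Pred ℝ 0ℓ
    IsTotalLength = IsLUB IsPartialLength

  -- The outer measure of A is finite and equal to m.
  IsOuterMeasure : Pred ℝ 0ℓ → Pred ℝ 0ℓ
  IsOuterMeasure A = IsGLB (λ v → Σ (OpenCover A) λ C → OpenCover.IsTotalLength C v)

  -- Carathéodory's condition; test sets of infinite outer measure impose no
  -- condition beyond countable subadditivity, so only finite ones appear.
  record IsMeasurable (A : Pred ℝ 0ℓ) : Set₁ where
    field
      respects-≈   : A Respects _≈_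
      carathéodory : (E : Pred ℝ 0ℓ) → ∀ {e e₁ e₂} →
        IsOuterMeasure E e → IsOuterMeasure (E ∩ A) e₁ → IsOuterMeasure (E ∩ ∁ A) e₂ →
        e ≈ e₁ + e₂

  record WeightedIndicator (X : Pred ℝ 0ℓ) : Set₁ where
    field
      coefficient   : ℝ
      coefficient≥0 : 0# ≤ coefficient
      set           : Pred ℝ 0ℓ
      set⊆X         : set ⊆ X
      set?          : Decidable set
      isMeasurable  : IsMeasurable set
      measure       : ℝ
      isMeasure     : IsOuterMeasure set measure

    value : ℝ → ℝ
    value t = if does (set? t) then coefficient else 0#

    integral : ℝ
    integral = coefficient * measure

  SimpleFunction : Pred ℝ 0ℓ → Set₁
  SimpleFunction X = List (WeightedIndicator X)

  simpleValue : ∀ {X} → SimpleFunction X → ℝ → ℝ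
  simpleValue s t = ∑ s (λ i → WeightedIndicator.value i t)

  simpleIntegral : ∀ {X} → SimpleFunction X → ℝ
  simpleIntegral s = ∑ s WeightedIndicator.integral

  module _ {a b : ℝ} (f : Func [ a , b ]ℝ ℝ≥0) where

    apply : ∀ t → Interval a b t → ℝ
    apply t t∈ = proj₁ (Func.to f (t , t∈))

    IsMeasurableFunction : Set₁
    IsMeasurableFunction = ∀ c → IsMeasurable (λ t → Σ (Interval a b t) λ t∈ → c < apply t t∈)

    IsSimpleIntegralBelow : Pred ℝ (suc 0ℓ)
    IsSimpleIntegralBelow v = Σ (SimpleFunction (Interval a b)) λ s →
      (∀ t (t∈ : Interval a b t) → simpleValue s t ≤ apply t t∈) × v ≈ simpleIntegral s

    -- f is Lebesgue measurable and its Lebesgue integral is finite, equal to I.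
    record IsLebesgueIntegral (I : ℝ) : Set₁ where
      field
        isMeasurable : IsMeasurableFunction
        isSupremum   : IsLUB IsSimpleIntegralBelow I

-- Walk R k x y: walks from x to y with k steps.
data Walk {A : Set} (R : Rel A 0ℓ) : ℕ → Rel A 0ℓ where
  []  : ∀ {x} → Walk R 0 x x
  _∷_ : ∀ {k x y z} → R x y → Walk R k y z → Walk R (ℕ.suc k) x z

module _ {R : Rel (Fin n) 0ℓ} (R? : Decidable₂ R) where

  walk? : ∀ k x y → Dec (Walk R k x y)
  walk? ℕ.zero x y = map′ (λ { refl → [] }) (λ { [] → refl }) (x Fin.≟ y)
  walk? (ℕ.suc k) x z =
    map′ (λ { (_ , r , p) → r ∷ p }) (λ { (r ∷ p) → _ , r , p })
      (Fin.any? λ y → R? x y ×-dec walk? k y z)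

least : {P : Pred ℕ 0ℓ} → Decidable P → ∃ P → ∃ (Bounds.IsMinimum ℕ._≤_ P)
least P? (k , pk) = go P? k pk
  where
  go : {P : Pred ℕ 0ℓ} → Decidable P → ∀ k → P k → ∃ (Bounds.IsMinimum ℕ._≤_ P)
  go P? ℕ.zero p = 0 , p , λ _ → ℕ.z≤n
  go {P} P? (ℕ.suc k) p with P? 0
  ... | yes p₀ = 0 , p₀ , λ _ → ℕ.z≤n
  ... | no ¬p₀ with go {λ j → P (ℕ.suc j)} (λ j → P? (ℕ.suc j)) k p
  ...   | m , pm , m≤ = ℕ.suc m , pm , bound
    where
    bound : ∀ {j} → P j → ℕ.suc m ℕ.≤ j
    bound {ℕ.zero} p₀ with () ← ¬p₀ p₀
    bound {ℕ.suc j} pj = ℕ.s≤s (m≤ pj)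

record ConnectedGraph (n : ℕ) : Set₁ where
  field
    Adj         : Rel (Fin n) 0ℓ
    adj?        : Decidable₂ Adj
    symmetric   : Symmetric Adj
    irreflexive : Irreflexive _≡_ Adj
    connected   : ∀ x y → ∃ λ k → Walk Adj k x y

  shortest : ∀ x y → ∃ (Bounds.IsMinimum ℕ._≤_ (λ k → Walk Adj k x y))
  shortest x y = least (λ k → walk? adj? k x y) (connected x y)

  dist : Fin n → Fin n → ℕ
  dist x y = proj₁ (shortest x y)

  diam : List (Fin n) → ℕ
  diam S = max 0 (map (λ (x , y) → dist x y) (cartesianProduct S S))

  -- Each edge is listed once, with its smaller endpoint first.
  edges : List (Fin n × Fin n)
  edges = filter (λ (x , y) → (x Fin.<? y) ×-dec adj? x y)
                 (cartesianProduct (allFin n) (allFin n))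

  InducesConnected : List (Fin n) → Set
  InducesConnected S = ∀ {x y} → x ∈ₗ S → y ∈ₗ S →
    ∃ λ k → Walk (λ u v → Adj u v × u ∈ₗ S × v ∈ₗ S) k x y
    where open import Data.List.Membership.Propositional renaming (_∈_ to _∈ₗ_)

data Tree (A : Set) : Set where
  leaf : A → Tree A
  node : Tree A → Tree A → Tree A

leaves : {A : Set} → Tree A → List A
leaves (leaf x)   = [ x ]
leaves (node l r) = leaves l ++ leaves r

clusters : {A : Set} → Tree A → List (List A)
clusters (leaf x)     = [ [ x ] ]
clusters t@(node l r) = leaves t ∷ clusters l ++ clusters r

-- An internal node, represented by the pair of its two children.  In a
-- hierarchy distinct internal nodes have distinct leaf sets, so listing nodes
-- is the same as listing clusters.
InternalNode : Set → Set
InternalNode A = Tree A × Tree A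

cluster : {A : Set} → InternalNode A → List A
cluster (l , r) = leaves l ++ leaves r

internalNodes : {A : Set} → Tree A → List (InternalNode A)
internalNodes (leaf _)   = []
internalNodes (node l r) = (l , r) ∷ internalNodes l ++ internalNodes r

module _ {n : ℕ} where
  open import Data.List.Membership.DecPropositional (Fin._≟_ {n}) public
    using () renaming (_∈_ to _∈ₗ_; _∈?_ to _∈ₗ?_)

  -- The cluster of the lowest common ancestor, for x and y leaves of the tree.
  lcaCluster : Tree (Fin n) → Fin n → Fin n → List (Fin n)
  lcaCluster (leaf v) x y = [ v ]
  lcaCluster (node l r) x y =
    if does ((x ∈ₗ? leaves l) ×-dec (y ∈ₗ? leaves l)) then lcaCluster l x y
    else if does ((x ∈ₗ? leaves r) ×-dec (y ∈ₗ? leaves r)) then lcaCluster r x y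
    else leaves l ++ leaves r

record Hierarchy (n : ℕ) : Set where
  field
    tree     : Tree (Fin n)
    leaves-↭ : leaves tree ↭ allFin n

  height : Fin n → Fin n → ℕ
  height x y = if does (x Fin.≟ y) then 0 else length (lcaCluster tree x y) ∸ 1

IsConnectedHierarchy : ConnectedGraph n → Hierarchy n → Set
IsConnectedHierarchy G T =
  All (ConnectedGraph.InducesConnected G) (clusters (Hierarchy.tree T))

module Optimisation (R : CompleteOrderedField) where
  open CompleteOrderedField R

  record Weights (G : ConnectedGraph n) : Set where
    open ConnectedGraph G
    field
      weight    : Fin n → Fin n → ℝ
      symmetric : ∀ {x y} → Adj x y → weight x y ≈ weight y x
      positive  : ∀ {x y} → Adj x y → 0# < weight x y

  IsUltrametric : (Fin n → Fin n → ℝ) → Set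
  IsUltrametric = IsGeneralMetric _≡_ _≈_ _≤_ 0# maxℝ

  module _ {n : ℕ} (G : ConnectedGraph n) (w : Weights G) where
    open ConnectedGraph G
    open Weights w using (weight)

    cost : (Fin n → Fin n → ℝ) → ℝ
    cost u = ∑ edges λ (x , y) → weight x y * u x y

    IsOPTfree : Pred ℝ 0ℓ
    IsOPTfree = IsMinimum λ v → ∃ λ u →
      IsUltrametric u × (∀ x y → fromℕ (dist x y) ≤ u x y) × v ≈ cost u

    IsOPTcard : Pred ℝ 0ℓ
    IsOPTcard = IsMinimum λ v → Σ (Hierarchy n) λ H →
      (∀ x y → dist x y ℕ.≤ Hierarchy.height H x y) ×
      v ≈ cost (λ x y → fromℕ (Hierarchy.height H x y))

    b : InternalNode (Fin n) → ℝ
    b (l , r) = ∑ (filter crosses? edges) λ (x , y) → weight x y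
      where
      crosses? : Decidable λ (x , y) →
        (x ∈ₗ leaves l × y ∈ₗ leaves r) ⊎ (x ∈ₗ leaves r × y ∈ₗ leaves l)
      crosses? (x , y) = ((x ∈ₗ? leaves l) ×-dec (y ∈ₗ? leaves r))
                   ⊎-dec ((x ∈ₗ? leaves r) ×-dec (y ∈ₗ? leaves l))

    Δ : InternalNode (Fin n) → ℕ
    Δ S = diam (cluster S)

    a-mass : InternalNode (Fin n) → ℝ
    a-mass S = fromℕ (Δ S) * b S

    ρ : InternalNode (Fin n) → ℝ
    ρ S = fromℕ (length (cluster S) ∸ 1) * fromℕ (Δ S) ⁻¹

    module _ (T : Hierarchy n) where
      open Hierarchy T using (tree)

      F : ℝ
      F = cost λ x y → fromℕ (diam (lcaCluster tree x y))

      μ : {P : Pred (InternalNode (Fin n)) ℓ} → Decidable P → ℝ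
      μ P? = ∑ (filter P? (internalNodes tree)) λ S → a-mass S * F ⁻¹

{-# OPTIONS --safe #-}
module Submission where

-- The hierarchy T itself, with heights |C| - 1, is a candidate for OPTcard, and
-- its cardinality cost is at most F(T) (1 + ∫Φ).
--
-- T is feasible because two vertices of a cluster that induces a connected
-- subgraph are joined by a walk with fewer steps than the cluster has vertices
-- (dist-connected).  For every function f of clusters, the edge sum of
-- w(x,y) f(C(x,y)) equals the sum of f(S) b(S) over the internal nodes S,
-- because an edge crosses exactly the node that is the lowest common ancestor
-- of its endpoints (cost-lca).  With f = diam this gives F(T) = ∑ a(S); with
-- f(C) = |C| - 1 it gives that the cardinality cost is ∑ a(S) ρ(S).  When F(T) is
-- nonzero, the μ(S) = a(S) / F(T) have sum 1, so the cardinality cost is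
-- F(T) (1 + ∑ μ(S) (ρ(S) - 1)).
--
-- The last sum is bounded by the layer-cake argument (layer-cake):
-- t ↦ μ{S : ρ(S) > t} restricted to t ≥ 1 is the simple function with
-- coefficient μ(S) on the half-open interval [1, ρ(S)), it lies below Φ, and its
-- integral is ∑ μ(S) (ρ(S) - 1).  This needs that a half-open interval is
-- Carathéodory measurable (halfOpen-isMeasurable) and that its outer measure is
-- its length (halfOpen-isOuterMeasure).  Measurability follows by cutting every
-- interval of a covering at the endpoints, and the lower bound for the outer
-- measure by a supremum argument in place of the Heine-Borel theorem
-- (length≤cover).
--
-- Inequalities between reals are decidable, hence stable under double negation,
-- so proofs of inequalities may reason by contradiction.

open import Defs
open import Level using (0ℓ)
import Algebra.Construct.NaturalChoice.Max as Max
import Algebra.Construct.NaturalChoice.Min as Min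
import Algebra.Properties.Ring as RingProperties
import Algebra.Properties.Semiring.Mult as SemiringMult
import Algebra.Solver.Ring as RingSolver
open import Algebra.Bundles using (CommutativeRing)
open import Algebra.Solver.Ring.AlmostCommutativeRing
  using (fromCommutativeRing; Induced-equivalence; _-Raw-AlmostCommutative⟶_)
open import Data.Bool.Base using (if_then_else_; true; false)
open import Data.Fin.Base using (Fin)
import Data.Fin.Properties as Fin
open import Data.Integer.Base as ℤ using (ℤ; +_; -[1+_]; _⊖_)
import Data.Integer.Properties as ℤ
open import Data.List.Base
  using (List; []; _∷_; _++_; applyUpTo; filter; length; allFin; cartesianProduct)
open import Data.List.Extrema.Nat using (xs≤max; max≤v⁺)
open import Data.List.Membership.Propositional using (_∈_)
open import Data.List.Membership.Propositional.Properties
  using (∈-++⁺ˡ; ∈-++⁺ʳ; ∈-++⁻; ∈-filter⁺; ∈-filter⁻; ∈-map⁺; ∈-cartesianProduct⁺;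
         ∈-cartesianProduct⁻; ∈-allFin)
open import Data.List.Properties using (filter-notAll; length-++-≤ˡ; length-++-≤ʳ; length-tabulate)
open import Data.List.Relation.Binary.Disjoint.Propositional using (Disjoint)
open import Data.List.Relation.Binary.Permutation.Propositional using (↭-sym; ↭⇒↭ₛ)
open import Data.List.Relation.Binary.Permutation.Propositional.Properties using (↭-length; ∈-resp-↭)
import Data.List.Relation.Binary.Permutation.Setoid.Properties as Permutation
open import Data.List.Relation.Unary.All as All using (All; []; _∷_)
import Data.List.Relation.Unary.All.Properties as All
open import Data.List.Relation.Unary.AllPairs using ([]; _∷_)
open import Data.List.Relation.Unary.Any as Any using (here; there)
open import Data.List.Relation.Unary.Unique.Propositional using (Unique)
open import Data.List.Relation.Unary.Unique.Propositional.Properties using (allFin⁺)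
import Data.Maybe.Base as Maybe
open import Data.Nat.Base as ℕ using (ℕ; _∸_)
import Data.Nat.Properties as ℕ
open import Data.Product.Base using (Σ; ∃; _×_; _,_; proj₁; proj₂)
import Data.Sign.Base as Sign
open import Data.Sum.Base using (_⊎_; inj₁; inj₂; [_,_]′)
open import Data.Unit.Base using (⊤)
open import Function.Base using (_∘_; id)
open import Function.Bundles using (Func)
open import Relation.Binary.Bundles using (DecTotalOrder)
open import Relation.Binary.PropositionalEquality as ≡ using (_≡_; _≢_; refl)
open import Relation.Binary.Definitions using (WeaklyDecidable)
import Relation.Binary.Reasoning.PartialOrder as PosetReasoning
import Relation.Binary.Reasoning.Setoid as SetoidReasoning
open import Relation.Nullary using (¬_; Dec; yes; no; contradiction; does)
open import Relation.Nullary.Decidable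
  using (_×-dec_; _⊎-dec_; ¬?; dec-true; dec-false; dec⇒maybe; decidable-stable)
open import Relation.Unary using (Pred; Decidable; _⊆_; _∩_; ∁; _∪_)

private
  variable
    n : ℕ

-- Arithmetic and order of the real field

module OrderedField (R : CompleteOrderedField) where
  open CompleteOrderedField R
  open CommutativeRing commutativeRing public
    using (+-cong; +-congˡ; +-congʳ; *-cong; *-congˡ; *-congʳ; -‿cong; +-identityˡ; +-identityʳ;
           *-identityˡ; *-identityʳ; zeroˡ; zeroʳ; *-comm; distribˡ; -‿inverseʳ)
  open CommutativeRing commutativeRing using (ring; semiring)
  open DecTotalOrder decTotalOrder public
    using (antisym; total; _≟_; module Eq)
    renaming (refl to ≤-refl; reflexive to ≤-reflexive; trans to ≤-trans;
              ≤-respʳ-≈ to ≤-respʳ; ≤-respˡ-≈ to ≤-respˡ)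
  open Eq public using () renaming (refl to ≈-refl; sym to ≈-sym; trans to ≈-trans)
  module ≈-Reasoning = SetoidReasoning ℝ-setoid
  module ≤-Reasoning = PosetReasoning (DecTotalOrder.poset decTotalOrder)

  open RingProperties ring using (-0#≈0#; -‿distribˡ-*; -‿distribʳ-*; -‿involutive; -‿+-comm)
  open SemiringMult semiring using (×-homo-+; ×1-homo-*)

  fromℕ-+ : ∀ m n → fromℕ (m ℕ.+ n) ≈ fromℕ m + fromℕ n
  fromℕ-+ = ×-homo-+ 1#

  -- The canonical homomorphism from the integers, whose images serve as the
  -- coefficients of normal forms.
  fromℤ : ℤ → ℝ
  fromℤ (+ n)    = fromℕ n
  fromℤ -[1+ n ] = - fromℕ (ℕ.suc n)

  private
    cancel-1 : ∀ x y → (1# + x) - (1# + y) ≈ x - y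
    cancel-1 x y = begin
      (1# + x) - (1# + y)         ≈⟨ +-congˡ (-‿+-comm 1# y) ⟨
      (1# + x) + (- 1# + - y)     ≈⟨ +-congʳ (CommutativeRing.+-comm commutativeRing 1# x) ⟩
      (x + 1#) + (- 1# + - y)     ≈⟨ +-assoc x 1# _ ⟩
      x + (1# + (- 1# + - y))     ≈⟨ +-congˡ (+-assoc 1# (- 1#) (- y)) ⟨
      x + ((1# + - 1#) + - y)     ≈⟨ +-congˡ (+-congʳ (-‿inverseʳ 1#)) ⟩
      x + (0# + - y)              ≈⟨ +-congˡ (+-identityˡ _) ⟩
      x - y                       ∎
      where
      open ≈-Reasoning
      open CommutativeRing commutativeRing using (+-assoc)

    fromℤ-⊖ : ∀ m n → fromℤ (m ⊖ n) ≈ fromℕ m - fromℕ n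
    fromℤ-⊖ m         ℕ.zero    = ≈-sym (≈-trans (+-congˡ -0#≈0#) (+-identityʳ _))
    fromℤ-⊖ ℕ.zero    (ℕ.suc n) = ≈-sym (+-identityˡ _)
    fromℤ-⊖ (ℕ.suc m) (ℕ.suc n) rewrite ℤ.[1+m]⊖[1+n]≡m⊖n m n =
      ≈-trans (fromℤ-⊖ m n) (≈-sym (cancel-1 (fromℕ m) (fromℕ n)))

    fromℤ-+ : ∀ i j → fromℤ (i ℤ.+ j) ≈ fromℤ i + fromℤ j
    fromℤ-+ (+ m)    (+ n)    = fromℕ-+ m n
    fromℤ-+ (+ m)    -[1+ n ] = fromℤ-⊖ m (ℕ.suc n)
    fromℤ-+ -[1+ m ] (+ n)    =
      ≈-trans (fromℤ-⊖ n (ℕ.suc m)) (CommutativeRing.+-comm commutativeRing _ _)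
    fromℤ-+ -[1+ m ] -[1+ n ] = begin
      - fromℕ (ℕ.suc (ℕ.suc (m ℕ.+ n)))       ≡⟨ ≡.cong (λ k → - fromℕ (ℕ.suc k)) (ℕ.+-suc m n) ⟨
      - fromℕ (ℕ.suc m ℕ.+ ℕ.suc n)           ≈⟨ -‿cong (fromℕ-+ (ℕ.suc m) (ℕ.suc n)) ⟩
      - (fromℕ (ℕ.suc m) + fromℕ (ℕ.suc n))   ≈⟨ -‿+-comm _ _ ⟨
      - fromℕ (ℕ.suc m) - fromℕ (ℕ.suc n)     ∎
      where open ≈-Reasoning

    fromℤ-◃ : ∀ n → fromℤ (Sign.- ℤ.◃ n) ≈ - fromℕ n
    fromℤ-◃ ℕ.zero    = ≈-sym -0#≈0#
    fromℤ-◃ (ℕ.suc n) = ≈-refl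

    fromℤ-* : ∀ i j → fromℤ (i ℤ.* j) ≈ fromℤ i * fromℤ j
    fromℤ-* (+ m) (+ n) rewrite ℤ.+◃n≡+n (m ℕ.* n) = ×1-homo-* m n
    fromℤ-* (+ m) -[1+ n ] =
      ≈-trans (fromℤ-◃ (m ℕ.* ℕ.suc n))
        (≈-trans (-‿cong (×1-homo-* m (ℕ.suc n))) (-‿distribʳ-* _ _))
    fromℤ-* -[1+ m ] (+ n) =
      ≈-trans (fromℤ-◃ (ℕ.suc m ℕ.* n))
        (≈-trans (-‿cong (×1-homo-* (ℕ.suc m) n)) (-‿distribˡ-* _ _))
    fromℤ-* -[1+ m ] -[1+ n ] = begin
      fromℕ (ℕ.suc m ℕ.* ℕ.suc n)               ≈⟨ ×1-homo-* (ℕ.suc m) (ℕ.suc n) ⟩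
      fromℕ (ℕ.suc m) * fromℕ (ℕ.suc n)         ≈⟨ -‿involutive _ ⟨
      - - (fromℕ (ℕ.suc m) * fromℕ (ℕ.suc n))   ≈⟨ -‿cong (-‿distribʳ-* _ _) ⟩
      - (fromℕ (ℕ.suc m) * - fromℕ (ℕ.suc n))   ≈⟨ -‿distribˡ-* _ _ ⟩
      - fromℕ (ℕ.suc m) * - fromℕ (ℕ.suc n)     ∎
      where open ≈-Reasoning

    fromℤ-neg : ∀ i → fromℤ (ℤ.- i) ≈ - fromℤ i
    fromℤ-neg (+ ℕ.zero)  = ≈-sym -0#≈0#
    fromℤ-neg (+ ℕ.suc n) = ≈-refl
    fromℤ-neg -[1+ n ]    = ≈-sym (-‿involutive _)

    almostCommutativeRing = fromCommutativeRing commutativeRing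

    morphism : ℤ.+-*-rawRing -Raw-AlmostCommutative⟶ almostCommutativeRing
    morphism = record
      { ⟦_⟧    = fromℤ
      ; +-homo = fromℤ-+
      ; *-homo = fromℤ-*
      ; -‿homo = fromℤ-neg
      ; 0-homo = ≈-refl
      ; 1-homo = +-identityʳ 1#
      }

    equalCoefficients? : WeaklyDecidable (Induced-equivalence morphism)
    equalCoefficients? i j = Maybe.map (λ { refl → ≈-refl }) (dec⇒maybe (i ℤ.≟ j))

  -- The ring solver, with integer coefficients so that it cancels x - x.
  open RingSolver ℤ.+-*-rawRing almostCommutativeRing morphism
    equalCoefficients? public
    using (solve; con; _:=_; _:+_; _:*_; _:-_; :-_)

  ≰⇒> : ∀ {x y} → ¬ x ≤ y → y < x
  ≰⇒> {x} {y} x≰y with total x y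
  ... | inj₁ x≤y = contradiction x≤y x≰y
  ... | inj₂ y≤x = y≤x , λ y≈x → x≰y (≤-reflexive (≈-sym y≈x))

  <⇒≱ : ∀ {x y} → x < y → ¬ y ≤ x
  <⇒≱ (x≤y , x≉y) y≤x = x≉y (antisym x≤y y≤x)

  ≮⇒≥ : ∀ {x y} → ¬ x < y → y ≤ x
  ≮⇒≥ {x} {y} x≮y = decidable-stable (y ≤? x) λ y≰x → x≮y (≰⇒> y≰x)

  ≤-stable : ∀ {x y} → ¬ ¬ x ≤ y → x ≤ y
  ≤-stable {x} {y} = decidable-stable (x ≤? y)

  ≤-<-trans : ∀ {x y z} → x ≤ y → y < z → x < z
  ≤-<-trans x≤y y<z = ≰⇒> λ z≤x → <⇒≱ y<z (≤-trans z≤x x≤y)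

  <-≤-trans : ∀ {x y z} → x < y → y ≤ z → x < z
  <-≤-trans x<y y≤z = ≰⇒> λ z≤x → <⇒≱ x<y (≤-trans y≤z z≤x)

  x≤y⇒0≤y-x : ∀ {x y} → x ≤ y → 0# ≤ y - x
  x≤y⇒0≤y-x {x} {y} x≤y = ≤-respˡ (solve 1 (λ x → :- x :+ x := con (+ 0)) ≈-refl x)
    (≤-respʳ (solve 2 (λ x y → :- x :+ y := y :- x) ≈-refl x y) (+-monoʳ-≤ (- x) x≤y))

  -- Linear inequalities are proved by writing the difference of the two sides
  -- as a sum of differences that are known to be nonnegative.
  ≤-from-0≤ : ∀ {p q d} → 0# ≤ d → q - p ≈ d → p ≤ q
  ≤-from-0≤ {p} {q} {d} 0≤d eq = ≤-respˡ (+-identityʳ p)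
    (≤-respʳ (≈-trans (+-congˡ (≈-sym eq)) (solve 2 (λ p q → p :+ (q :- p) := q) ≈-refl p q))
      (+-monoʳ-≤ p 0≤d))

  0≤+ : ∀ {x y} → 0# ≤ x → 0# ≤ y → 0# ≤ x + y
  0≤+ {x} {y} 0≤x 0≤y =
    ≤-trans 0≤x (≤-from-0≤ 0≤y (solve 2 (λ x y → x :+ y :- x := y) ≈-refl x y))

  ≤-from : ∀ {p q x y} → x ≤ y → q - p ≈ y - x → p ≤ q
  ≤-from x≤y = ≤-from-0≤ (x≤y⇒0≤y-x x≤y)

  ≤-from₂ : ∀ {p q x y u v} → x ≤ y → u ≤ v → q - p ≈ (y - x) + (v - u) → p ≤ q
  ≤-from₂ x≤y u≤v = ≤-from-0≤ (0≤+ (x≤y⇒0≤y-x x≤y) (x≤y⇒0≤y-x u≤v))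

  +-mono-≤ : ∀ {x y u v} → x ≤ y → u ≤ v → x + u ≤ y + v
  +-mono-≤ {x} {y} {u} {v} x≤y u≤v = ≤-from₂ x≤y u≤v
    (solve 4 (λ x y u v → y :+ v :- (x :+ u) := y :- x :+ (v :- u)) ≈-refl x y u v)

  *-monoʳ-≤ : ∀ {z x y} → 0# ≤ z → x ≤ y → z * x ≤ z * y
  *-monoʳ-≤ {z} {x} {y} 0≤z x≤y = ≤-from-0≤ (*-nonNegative 0≤z (x≤y⇒0≤y-x x≤y))
    (solve 3 (λ x y z → z :* y :- z :* x := z :* (y :- x)) ≈-refl x y z)

  0≤1 : 0# ≤ 1#
  0≤1 with total 0# 1#
  ... | inj₁ 0≤1 = 0≤1
  ... | inj₂ 1≤0 = ≤-respʳ (≈-trans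
      (solve 1 (λ x → (con (+ 0) :- x) :* (con (+ 0) :- x) := x :* x) ≈-refl 1#)
      (*-identityˡ 1#))
      (*-nonNegative 0≤-1 0≤-1)
    where
    0≤-1 : 0# ≤ 0# - 1#
    0≤-1 = x≤y⇒0≤y-x 1≤0

  0≤fromℕ : ∀ n → 0# ≤ fromℕ n
  0≤fromℕ ℕ.zero    = ≤-refl
  0≤fromℕ (ℕ.suc n) = 0≤+ 0≤1 (0≤fromℕ n)

  fromℕ-mono : ∀ {m n} → m ℕ.≤ n → fromℕ m ≤ fromℕ n
  fromℕ-mono {n = n} ℕ.z≤n     = 0≤fromℕ n
  fromℕ-mono         (ℕ.s≤s m≤n) = +-monoʳ-≤ 1# (fromℕ-mono m≤n)

  1≤fromℕ : ∀ {n} → 1 ℕ.≤ n → 1# ≤ fromℕ n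
  1≤fromℕ 1≤n = ≤-respˡ (+-identityʳ 1#) (fromℕ-mono 1≤n)

  1≤⇒≉0 : ∀ {x} → 1# ≤ x → ¬ x ≈ 0#
  1≤⇒≉0 1≤x x≈0 = 0≉1 (antisym 0≤1 (≤-respʳ x≈0 1≤x))

  0≤⁻¹ : ∀ {x} → 0# ≤ x → ¬ x ≈ 0# → 0# ≤ x ⁻¹
  0≤⁻¹ {x} 0≤x x≉0 with total 0# (x ⁻¹)
  ... | inj₁ 0≤x⁻¹ = 0≤x⁻¹
  ... | inj₂ x⁻¹≤0 = contradiction (antisym 0≤1 1≤0) 0≉1
    where
    1≤0 : 1# ≤ 0#
    1≤0 = ≤-from-0≤ (*-nonNegative 0≤x (x≤y⇒0≤y-x x⁻¹≤0)) (≈-trans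
      (+-congˡ (-‿cong (≈-sym (⁻¹-inverseˡ x≉0))))
      (solve 2 (λ x y → con (+ 0) :- y :* x := x :* (con (+ 0) :- y)) ≈-refl x (x ⁻¹)))

  half : ∀ {d} → 0# < d → ∃ λ h → 0# < h × h + h ≈ d
  half {d} 0<d = h , ≰⇒> h≰0 , h+h≈d
    where
    2# = 1# + 1#
    2≉0 : ¬ 2# ≈ 0#
    2≉0 = 1≤⇒≉0 (≤-from 0≤1 (solve 1 (λ x → x :+ x :- x := x :- con (+ 0)) ≈-refl 1#))
    h = 2# ⁻¹ * d
    h+h≈d : h + h ≈ d
    h+h≈d = begin
      h + h             ≈⟨ solve 2 (λ x d → x :* d :+ x :* d := x :* con (+ 2) :* d) ≈-refl (2# ⁻¹) d ⟩
      2# ⁻¹ * fromℕ 2 * d ≈⟨ *-congʳ (*-congˡ (+-congˡ (+-identityʳ 1#))) ⟩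
      2# ⁻¹ * 2# * d    ≈⟨ *-congʳ (⁻¹-inverseˡ 2≉0) ⟩
      1# * d            ≈⟨ *-identityˡ d ⟩
      d                 ∎
      where open ≈-Reasoning
    h≰0 : ¬ h ≤ 0#
    h≰0 h≤0 = <⇒≱ 0<d (≤-respˡ h+h≈d (≤-respʳ (+-identityˡ 0#) (+-mono-≤ h≤0 h≤0)))

  x<y⇒0<y-x : ∀ {x y} → x < y → 0# < y - x
  x<y⇒0<y-x {x} {y} x<y = ≰⇒> λ y-x≤0 → <⇒≱ x<y
    (≤-from y-x≤0 (solve 2 (λ x y → x :- y := con (+ 0) :- (y :- x)) ≈-refl x y))

  ≤-approx : ∀ {x y} → (∀ ε → 0# < ε → x ≤ y + ε) → x ≤ y
  -- If y < x, then half of x - y is an ε that violates the hypothesis.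
  ≤-approx {x} {y} x≤y+ = ≤-stable λ x≰y →
    let h , 0<h , h+h≈x-y = half (x<y⇒0<y-x (≰⇒> x≰y))
    in <⇒≱ 0<h (≤-from (x≤y+ h 0<h) (≈-trans
         (solve 1 (λ h → con (+ 0) :- h := h :- (h :+ h)) ≈-refl h)
         (≈-trans (+-congˡ (-‿cong h+h≈x-y))
           (solve 3 (λ x y h → h :- (x :- y) := y :+ h :- x) ≈-refl x y h))))

-- Outer measure and measurability of half-open intervals

module Measure (R : CompleteOrderedField) where
  open CompleteOrderedField R
  open OrderedField R
  open LebesgueIntegral R

  -- The sum of the first N terms of a sequence.
  ∑< : ℕ → (ℕ → ℝ) → ℝ
  ∑< ℕ.zero    h = 0#
  ∑< (ℕ.suc N) h = h 0 + ∑< N (h ∘ ℕ.suc)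

  ∑-applyUpTo : ∀ N (φ : ℕ → ℕ) h → ∑ (applyUpTo φ N) h ≡ ∑< N (h ∘ φ)
  ∑-applyUpTo ℕ.zero    φ h = refl
  ∑-applyUpTo (ℕ.suc N) φ h = ≡.cong (λ s → h (φ 0) + s) (∑-applyUpTo N (φ ∘ ℕ.suc) h)

  ∑<-mono-length : ∀ {h} → (∀ k → 0# ≤ h k) → ∀ {M N} → M ℕ.≤ N → ∑< M h ≤ ∑< N h
  ∑<-mono-length h≥0 {N = ℕ.zero}  ℕ.z≤n = ≤-refl
  ∑<-mono-length h≥0 {N = ℕ.suc N} ℕ.z≤n =
    0≤+ (h≥0 0) (∑<-mono-length (h≥0 ∘ ℕ.suc) (ℕ.z≤n {N}))
  ∑<-mono-length h≥0 (ℕ.s≤s M≤N) = +-monoʳ-≤ _ (∑<-mono-length (h≥0 ∘ ℕ.suc) M≤N)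

  ∑<-mono : ∀ N {g h} → (∀ k → g k ≤ h k) → ∑< N g ≤ ∑< N h
  ∑<-mono ℕ.zero    g≤h = ≤-refl
  ∑<-mono (ℕ.suc N) g≤h = +-mono-≤ (g≤h 0) (∑<-mono N (g≤h ∘ ℕ.suc))

  ∑<-+ : ∀ N {f g h} → (∀ k → f k + g k ≈ h k) → ∑< N f + ∑< N g ≈ ∑< N h
  ∑<-+ ℕ.zero    eq = +-identityˡ 0#
  ∑<-+ (ℕ.suc N) eq = ≈-trans
    (solve 4 (λ a b c d → (a :+ b) :+ (c :+ d) := (a :+ c) :+ (b :+ d)) ≈-refl _ _ _ _)
    (+-cong (eq 0) (∑<-+ N (eq ∘ ℕ.suc)))

  -- A termwise bound whose j-th term has slack d.
  ∑<-gap : ∀ {N j g h d} → j ℕ.< N → (∀ k → g k ≤ h k) → g j + d ≤ h j → ∑< N g + d ≤ ∑< N h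
  ∑<-gap {ℕ.suc N} {ℕ.zero} {g} {h} {d} _ g≤h gap = ≤-from₂ gap (∑<-mono N (g≤h ∘ ℕ.suc))
    (solve 5 (λ a b c e d → a :+ b :- (c :+ e :+ d) := (a :- (c :+ d)) :+ (b :- e)) ≈-refl
      (h 0) (∑< N (h ∘ ℕ.suc)) (g 0) (∑< N (g ∘ ℕ.suc)) d)
  ∑<-gap {ℕ.suc N} {ℕ.suc j} {g} {h} {d} (ℕ.s≤s j<N) g≤h gap =
    ≤-from₂ (g≤h 0) (∑<-gap j<N (g≤h ∘ ℕ.suc) gap)
    (solve 5 (λ a b c e d → a :+ b :- (c :+ e :+ d) := (a :- c) :+ (b :- (e :+ d))) ≈-refl
      (h 0) (∑< N (h ∘ ℕ.suc)) (g 0) (∑< N (g ∘ ℕ.suc)) d)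

  open Min totalOrder using (_⊓_; ⊓-mono-≤; x≤y⇒x⊓y≈x; x≤y⇒y⊓x≈x; x⊓y≤x; x⊓y≤y)
  open Max totalOrder using (_⊔_; ⊔-mono-≤; x≤y⇒x⊔y≈y; x≤y⇒y⊔x≈y; x≤x⊔y)

  ⊓+⊔ : ∀ x y → (x ⊓ y) + (x ⊔ y) ≈ x + y
  ⊓+⊔ x y = [ (λ x≤y → +-cong (x≤y⇒x⊓y≈x x≤y) (x≤y⇒x⊔y≈y x≤y))
            , (λ y≤x → ≈-trans (+-cong (x≤y⇒y⊓x≈x y≤x) (x≤y⇒y⊔x≈y y≤x))
                (solve 2 (λ x y → y :+ x := x :+ y) ≈-refl x y)) ]′ (total x y)

  <-⊓ : ∀ {x y z} → x < y → x < z → x < y ⊓ z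
  <-⊓ {x} {y} {z} x<y x<z with total y z
  ... | inj₁ _ = x<y
  ... | inj₂ _ = x<z

  ⊔-< : ∀ {x y z} → x < z → y < z → x ⊔ y < z
  ⊔-< {x} {y} {z} x<z y<z with total x y
  ... | inj₁ x≤y = ≤-<-trans (≤-reflexive (x≤y⇒x⊔y≈y x≤y)) y<z
  ... | inj₂ y≤x = ≤-<-trans (≤-reflexive (x≤y⇒y⊔x≈y y≤x)) x<z

  -- A possibly empty open interval, given by its endpoints.
  record OpenInterval : Set where
    constructor openInterval
    field
      {lo hi} : ℝ
      lo≤hi   : lo ≤ hi

    len : ℝ
    len = hi - lo

    0≤len : 0# ≤ len
    0≤len = x≤y⇒0≤y-x lo≤hi

  open OpenInterval

  infix 4 _∈ᵒ_

  -- Membership in the open interval.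
  _∈ᵒ_ : ℝ → OpenInterval → Set
  x ∈ᵒ i = lo i < x × x < hi i

  -- A filler for the unused indices of a finite covering.
  empty : OpenInterval
  empty = openInterval {0#} {0#} ≤-refl

  -- The parts of an open interval below and above c, with endpoints clamped to c;
  -- a part that would be empty becomes the degenerate interval (c, c).
  below above : ℝ → OpenInterval → OpenInterval
  below c i = openInterval (⊓-mono-≤ (lo≤hi i) (≤-refl {c}))
  above c i = openInterval (⊔-mono-≤ (lo≤hi i) (≤-refl {c}))

  len-cut : ∀ c i → len (below c i) + len (above c i) ≈ len i
  len-cut c i = begin
    ((h ⊓ c) - (l ⊓ c)) + ((h ⊔ c) - (l ⊔ c))
      ≈⟨ solve 4 (λ a b c d → (a :- b) :+ (c :- d) := (a :+ c) :- (b :+ d)) ≈-refl _ _ _ _ ⟩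
    ((h ⊓ c) + (h ⊔ c)) - ((l ⊓ c) + (l ⊔ c))
      ≈⟨ +-cong (⊓+⊔ h c) (-‿cong (⊓+⊔ l c)) ⟩
    (h + c) - (l + c)
      ≈⟨ solve 3 (λ h l c → (h :+ c) :- (l :+ c) := h :- l) ≈-refl h l c ⟩
    h - l ∎
    where
    open ≈-Reasoning
    l = lo i
    h = hi i

  -- A covering of A by countably many open intervals of total length at most v.
  -- The length is bounded through the partial sums, so that no series has to be
  -- summed; outer measure is the infimum of these v.
  record CoveredWithin (A : Pred ℝ 0ℓ) (v : ℝ) : Set where
    constructor coveredWithin
    field
      intervals : ℕ → OpenInterval
      covers    : ∀ {x} → A x → ∃ λ k → x ∈ᵒ intervals k
      bounded   : ∀ N → ∑< N (len ∘ intervals) ≤ v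

  module _ {A : Pred ℝ 0ℓ} where

    fromOpenCover : ∀ {v} (C : OpenCover A) → OpenCover.IsTotalLength C v → CoveredWithin A v
    fromOpenCover {v} C (isUpper , _) = coveredWithin
      (λ k → openInterval (left≤right k)) covers
      (λ N → isUpper (N , ≈-sym (Eq.reflexive (∑-applyUpTo N id (λ k → right k - left k)))))
      where open OpenCover C

    -- The total length u is the supremum of the partial lengths; it may be less than v.
    toOpenCover : ∀ {v} → CoveredWithin A v →
      Σ (OpenCover A) λ C → ∃ λ u → OpenCover.IsTotalLength C u × u ≤ v
    toOpenCover {v} (coveredWithin is covers bounded) = C , u , isLUB , proj₂ isLUB v bound
      where
      C : OpenCover A
      C = record { left = lo ∘ is ; right = hi ∘ is ; left≤right = λ k → lo≤hi (is k) ; covers = covers }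
      bound : IsUpperBound (OpenCover.IsPartialLength C) v
      bound (N , s≈) = ≤-respˡ (≈-sym (≈-trans s≈ (Eq.reflexive (∑-applyUpTo N id (len ∘ is))))) (bounded N)
      total-length = supremum (OpenCover.IsPartialLength C) (0# , 0 , ≈-refl) (v , bound)
      u = proj₁ total-length
      isLUB = proj₂ total-length

    outerMeasure-≤ : ∀ {m v} → IsOuterMeasure A m → CoveredWithin A v → m ≤ v
    outerMeasure-≤ (lower , _) c = let C , u , isTotal , u≤v = toOpenCover c in
      ≤-trans (lower (C , isTotal)) u≤v

    outerMeasure-glb : ∀ {m d} → IsOuterMeasure A m → (∀ {v} → CoveredWithin A v → d ≤ v) → d ≤ m
    outerMeasure-glb (_ , greatest) lower = greatest _ λ (C , isTotal) → lower (fromOpenCover C isTotal)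

    isOuterMeasure : ∀ {m} → (∀ {v} → CoveredWithin A v → m ≤ v) →
      (∀ ε → 0# < ε → CoveredWithin A (m + ε)) → IsOuterMeasure A m
    isOuterMeasure lower approx =
      (λ (C , isTotal) → lower (fromOpenCover C isTotal)) ,
      λ d isLower → ≤-approx λ ε 0<ε →
        let C , u , isTotal , u≤ = toOpenCover (approx ε 0<ε) in ≤-trans (isLower (C , isTotal)) u≤

  covered-⊆ : ∀ {A B v} → A ⊆ B → CoveredWithin B v → CoveredWithin A v
  covered-⊆ A⊆B (coveredWithin is covers bounded) = coveredWithin is (covers ∘ A⊆B) bounded

  covered-≤ : ∀ {A u v} → u ≤ v → CoveredWithin A u → CoveredWithin A v
  covered-≤ u≤v (coveredWithin is covers bounded) =
    coveredWithin is covers λ N → ≤-trans (bounded N) u≤v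

  covered-interval : ∀ {A} i → (∀ {x} → A x → x ∈ᵒ i) → CoveredWithin A (len i)
  covered-interval {A} i A⊆i = coveredWithin is (λ x∈A → 0 , A⊆i x∈A) bounded
    where
    is : ℕ → OpenInterval
    is ℕ.zero    = i
    is (ℕ.suc _) = empty
    rest : ∀ N → ∑< N (λ _ → len empty) ≤ 0#
    rest ℕ.zero    = ≤-refl
    rest (ℕ.suc N) = ≤-respʳ (≈-trans (+-congʳ (-‿inverseʳ 0#)) (+-identityˡ 0#))
      (+-monoʳ-≤ (len empty) (rest N))
    bounded : ∀ N → ∑< N (len ∘ is) ≤ len i
    bounded ℕ.zero    = 0≤len i
    bounded (ℕ.suc N) = ≤-respʳ (+-identityʳ _) (+-monoʳ-≤ (len i) (rest N))

  covered-point : ∀ c ε → 0# < ε → CoveredWithin (_≈ c) ε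
  covered-point c ε 0<ε = covered-≤ len≤ε (covered-interval i λ x≈c →
      ≰⇒> (λ x≤c-h → <⇒≱ 0<h (≤-from (≤-respˡ x≈c x≤c-h) (left-gap c h))) ,
      ≰⇒> (λ c+h≤x → <⇒≱ 0<h (≤-from (≤-respʳ x≈c c+h≤x) (right-gap c h))))
    where
    h    = proj₁ (half 0<ε)
    0<h  = proj₁ (proj₂ (half 0<ε))
    h+h≈ = proj₂ (proj₂ (half 0<ε))
    left-gap : ∀ c h → 0# - h ≈ (c - h) - c
    left-gap = solve 2 (λ c h → con (+ 0) :- h := (c :- h) :- c) ≈-refl
    right-gap : ∀ c h → 0# - h ≈ c - (c + h)
    right-gap = solve 2 (λ c h → con (+ 0) :- h := c :- (c :+ h)) ≈-refl
    i : OpenInterval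
    i = openInterval {c - h} {c + h} (≤-from (≤-respʳ h+h≈ (0≤+ (proj₁ 0<h) (proj₁ 0<h)))
      (≈-trans (solve 2 (λ c h → c :+ h :- (c :- h) := h :+ h :- con (+ 0)) ≈-refl c h)
        (+-congʳ h+h≈)))
    len≤ε : len i ≤ ε
    len≤ε = ≤-reflexive (≈-trans
      (solve 2 (λ c h → c :+ h :- (c :- h) := h :+ h) ≈-refl c h) h+h≈)

  -- The sequence f 0, g 0, f 1, g 1, ...
  interleave : ∀ {A : Set} → (ℕ → A) → (ℕ → A) → ℕ → A
  interleave f g ℕ.zero    = f 0
  interleave f g (ℕ.suc k) = interleave g (f ∘ ℕ.suc) k

  module _ {A : Set} where
    interleave-fst : ∀ (f g : ℕ → A) k → ∃ λ j → interleave f g j ≡ f k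
    interleave-snd : ∀ (f g : ℕ → A) k → ∃ λ j → interleave f g j ≡ g k
    interleave-fst f g ℕ.zero    = 0 , refl
    interleave-fst f g (ℕ.suc k) = let j , eq = interleave-snd g (f ∘ ℕ.suc) k in ℕ.suc j , eq
    interleave-snd f g k         = let j , eq = interleave-fst g (f ∘ ℕ.suc) k in ℕ.suc j , eq

    ∑<-interleave : ∀ (h : A → ℝ) N f g →
      ∃ λ i → ∃ λ j → ∑< N (h ∘ interleave f g) ≈ ∑< i (h ∘ f) + ∑< j (h ∘ g)
    ∑<-interleave h ℕ.zero    f g = 0 , 0 , ≈-sym (+-identityˡ 0#)
    ∑<-interleave h (ℕ.suc N) f g =
      let i , j , eq = ∑<-interleave h N g (f ∘ ℕ.suc) in
      ℕ.suc j , i , ≈-trans (+-congˡ eq)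
        (solve 3 (λ a b c → a :+ (b :+ c) := (a :+ c) :+ b) ≈-refl
          (h (f 0)) (∑< i (h ∘ g)) (∑< j (h ∘ f ∘ ℕ.suc)))

  covered-∪ : ∀ {A B u v} → CoveredWithin A u → CoveredWithin B v → CoveredWithin (A ∪ B) (u + v)
  covered-∪ {A} {B} {u} {v} (coveredWithin is coversA boundA) (coveredWithin js coversB boundB) =
    coveredWithin (interleave is js) covers bounded
    where
    covers : ∀ {x} → (A ∪ B) x → ∃ λ k → x ∈ᵒ interleave is js k
    covers {x} (inj₁ x∈A) = let k , x∈ = coversA x∈A ; j , eq = interleave-fst is js k in
      j , ≡.subst (x ∈ᵒ_) (≡.sym eq) x∈
    covers {x} (inj₂ x∈B) = let k , x∈ = coversB x∈B ; j , eq = interleave-snd is js k in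
      j , ≡.subst (x ∈ᵒ_) (≡.sym eq) x∈
    bounded : ∀ N → ∑< N (len ∘ interleave is js) ≤ u + v
    bounded N = let i , j , eq = ∑<-interleave len N is js in
      ≤-respˡ (≈-sym eq) (+-mono-≤ (boundA i) (boundB j))

  -- Every interval of the covering is cut at c.  The point c itself is covered by
  -- neither part.  The length u of the lower part is the supremum of its partial
  -- lengths, and v - u bounds the partial lengths of the upper part because the two
  -- parts of an interval have the length of the interval as their sum.
  covered-cut : ∀ {A v} c → CoveredWithin A v → ∃ λ u →
    CoveredWithin (A ∩ (_< c)) u × CoveredWithin (A ∩ (c <_)) (v - u)
  covered-cut {A} {v} c (coveredWithin is covers bounded) =
    u ,
    coveredWithin bs (λ {x} (x∈A , x<c) → let k , lo< , <hi = covers x∈A in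
      k , ≤-<-trans (x⊓y≤x _ c) lo< , <-⊓ <hi x<c) (λ N → proj₁ isLUB (N , ≈-refl)) ,
    coveredWithin as (λ {x} (x∈A , c<x) → let k , lo< , <hi = covers x∈A in
      k , ⊔-< lo< c<x , <-≤-trans <hi (x≤x⊔y _ c))
      λ N → ≤-from (proj₂ isLUB (v - ∑< N (len ∘ as)) λ { (M , s≈) → ≤-respˡ (≈-sym s≈) (≤-from (sum≤v M N)
        (solve 3 (λ v a b → (v :- a) :- b := v :- (b :+ a)) ≈-refl _ _ _)) })
        (solve 3 (λ v u a → (v :- u) :- a := (v :- a) :- u) ≈-refl _ _ _)
    where
    bs as : ℕ → OpenInterval
    bs = below c ∘ is
    as = above c ∘ is
    sum≤v : ∀ M N → ∑< M (len ∘ bs) + ∑< N (len ∘ as) ≤ v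
    sum≤v M N = ≤-trans
      (+-mono-≤ (∑<-mono-length (0≤len ∘ bs) (ℕ.m≤m⊔n M N)) (∑<-mono-length (0≤len ∘ as) (ℕ.m≤n⊔m M N)))
      (≤-respˡ (≈-sym (∑<-+ (M ℕ.⊔ N) (λ k → len-cut c (is k)))) (bounded (M ℕ.⊔ N)))
    lengths : Pred ℝ 0ℓ
    lengths s = ∃ λ N → s ≈ ∑< N (len ∘ bs)
    sup = supremum lengths (0# , 0 , ≈-refl)
      (v , λ { (M , s≈) → ≤-respˡ (≈-trans (+-identityʳ _) (≈-sym s≈)) (sum≤v M 0) })
    u = proj₁ sup
    isLUB = proj₂ sup

  -- The half-open interval [a, b).
  HalfOpen : ℝ → ℝ → Pred ℝ 0ℓ
  HalfOpen a b t = a ≤ t × t < b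

  halfOpen? : ∀ a b → Decidable (HalfOpen a b)
  halfOpen? a b t = (a ≤? t) ×-dec (t <? b)

  below-≤ : ∀ x i → len (below x i) ≤ len i
  below-≤ x i = ≤-from (0≤len (above x i)) (≈-trans (+-congʳ (≈-sym (len-cut x i)))
    (solve 2 (λ b a → b :+ a :- b := a :- con (+ 0)) ≈-refl (len (below x i)) (len (above x i))))

  below-mono : ∀ {x y} i → x ≤ y → len (below x i) ≤ len (below y i)
  below-mono {x} {y} i x≤y = [
    (λ lo≤x → +-mono-≤ (⊓-mono-≤ (≤-refl {hi i}) x≤y)
      (≤-reflexive (-‿cong (≈-trans (x≤y⇒x⊓y≈x lo≤x) (≈-sym (x≤y⇒x⊓y≈x (≤-trans lo≤x x≤y)))))))
    , (λ x≤lo → ≤-respˡ (≈-sym (≈-trans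
        (+-cong (x≤y⇒y⊓x≈x (≤-trans x≤lo (lo≤hi i))) (-‿cong (x≤y⇒y⊓x≈x x≤lo))) (-‿inverseʳ x)))
        (0≤len (below y i))) ]′ (total (lo i) x)

  -- Moving the cut from x to y inside an interval lengthens its lower part by y - x.
  below-gap : ∀ {x y} i → lo i ≤ x → x ≤ y → y ≤ hi i → len (below x i) + (y - x) ≤ len (below y i)
  below-gap {x} {y} i lo≤x x≤y y≤hi = ≤-reflexive (begin
    (hi i ⊓ x - lo i ⊓ x) + (y - x)
      ≈⟨ +-congʳ (+-cong (x≤y⇒y⊓x≈x (≤-trans x≤y y≤hi)) (-‿cong (x≤y⇒x⊓y≈x lo≤x))) ⟩
    (x - lo i) + (y - x)
      ≈⟨ solve 3 (λ x y l → (x :- l) :+ (y :- x) := y :- l) ≈-refl x y (lo i) ⟩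
    y - lo i
      ≈⟨ +-cong (x≤y⇒y⊓x≈x y≤hi) (-‿cong (x≤y⇒x⊓y≈x (≤-trans lo≤x x≤y))) ⟨
    hi i ⊓ y - lo i ⊓ y ∎)
    where open ≈-Reasoning

  -- Call a point x of [a, b] reached if, for some N, the parts below x of the first N
  -- intervals of the covering have total length at least x - a.  The supremum s of the reached points is b:
  -- otherwise s lies in an interval of the covering, which also contains a reached
  -- point x to the left of s, and replacing x by a point of that interval to the
  -- right of s gives a reached point beyond s.
  length≤cover : ∀ {a b v} → a ≤ b → CoveredWithin (HalfOpen a b) v → b - a ≤ v
  length≤cover {a} {b} {v} a≤b (coveredWithin is covers bounded) =
    ≤-from (≤-trans b≤s s≤v+a) (solve 3 (λ a b v → v :- (b :- a) := v :+ a :- b) ≈-refl a b v)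
    where
    -- The total length below x of the first N intervals.
    filled : ℕ → ℝ → ℝ
    filled N x = ∑< N (len ∘ below x ∘ is)

    Reached : Pred ℝ 0ℓ
    Reached x = (a ≤ x × x ≤ b) × ∃ λ N → x - a ≤ filled N x

    a∈ : Reached a
    a∈ = (≤-refl , a≤b) , 0 , ≤-reflexive (-‿inverseʳ a)

    sup = supremum Reached (a , a∈) (b , proj₂ ∘ proj₁)
    s = proj₁ sup
    upper = proj₁ (proj₂ sup)
    least-upper = proj₂ (proj₂ sup)

    s≤v+a : s ≤ v + a
    s≤v+a = least-upper (v + a) λ { {x} (_ , N , x-a≤) →
      ≤-from (≤-trans x-a≤ (≤-trans (∑<-mono N (below-≤ x ∘ is)) (bounded N)))
        (solve 3 (λ a x v → v :+ a :- x := v :- (x :- a)) ≈-refl a x v) }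

    -- The number of intervals is raised to exceed k before moving to y.
    step : ∀ {x y k} → Reached x → lo (is k) ≤ x → x ≤ y → y ≤ b → y ≤ hi (is k) → Reached y
    step {x} {y} {k} ((a≤x , _) , N , x-a≤) lo≤x x≤y y≤b y≤hi =
      (≤-trans a≤x x≤y , y≤b) , M ,
      ≤-trans
        (≤-from (≤-trans x-a≤ (∑<-mono-length (0≤len ∘ below x ∘ is) (ℕ.m≤m⊔n N (ℕ.suc k))))
          (solve 4 (λ a x y f → f :+ (y :- x) :- (y :- a) := f :- (x :- a)) ≈-refl a x y (filled M x)))
        (∑<-gap (ℕ.m≤n⊔m N (ℕ.suc k)) (λ j → below-mono (is j) x≤y) (below-gap (is k) lo≤x x≤y y≤hi))
      where M = N ℕ.⊔ ℕ.suc k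

    b≤s : b ≤ s
    b≤s = ≮⇒≥ λ s<b →
      let k , lo<s , s<hi = covers (upper a∈ , s<b)
          -- The new point y is the minimum of b and the right end of that interval.
          s<y = <-⊓ s<b s<hi
      in <⇒≱ lo<s (least-upper (lo (is k)) λ x∈ → ≤-stable λ x≰lo →
        <⇒≱ s<y (upper (step x∈ (proj₁ (≰⇒> x≰lo)) (≤-trans (upper x∈) (proj₁ s<y))
          (x⊓y≤x b _) (x⊓y≤y b _))))

  halfOpen-isOuterMeasure : ∀ {a b} → a ≤ b → IsOuterMeasure (HalfOpen a b) (b - a)
  halfOpen-isOuterMeasure {a} {b} a≤b = isOuterMeasure (length≤cover a≤b) λ ε 0<ε →
    covered-≤ (≤-reflexive (solve 3 (λ a b ε → b :- (a :- ε) := b :- a :+ ε) ≈-refl a b ε))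
      (covered-interval
        (openInterval {a - ε} {b} (≤-from₂ a≤b (proj₁ 0<ε)
          (solve 3 (λ a b ε → b :- (a :- ε) := (b :- a) :+ (ε :- con (+ 0))) ≈-refl a b ε)))
        λ (a≤x , x<b) → <-≤-trans (a-ε<a ε 0<ε) a≤x , x<b)
    where
    a-ε<a : ∀ ε → 0# < ε → a - ε < a
    a-ε<a ε 0<ε = ≰⇒> λ a≤a-ε → <⇒≱ 0<ε (≤-from a≤a-ε
      (solve 2 (λ a ε → con (+ 0) :- ε := a :- ε :- a) ≈-refl a ε))

  halfOpen-isMeasurable : ∀ {a b} → a ≤ b → IsMeasurable (HalfOpen a b)
  halfOpen-isMeasurable {a} {b} a≤b = record { respects-≈ = respects ; carathéodory = carathéodory }
    where
    A = HalfOpen a b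

    respects : ∀ {x y} → x ≈ y → A x → A y
    respects x≈y (a≤x , x<b) =
      ≤-trans a≤x (≤-reflexive x≈y) , ≤-<-trans (≤-reflexive (≈-sym x≈y)) x<b

    carathéodory : (E : Pred ℝ 0ℓ) → ∀ {e e₁ e₂} → IsOuterMeasure E e →
      IsOuterMeasure (E ∩ A) e₁ → IsOuterMeasure (E ∩ ∁ A) e₂ → e ≈ e₁ + e₂
    carathéodory E {e} {e₁} {e₂} outer outer₁ outer₂ = antisym e≤ ≤e
      where
      -- Subadditivity, with the infima over coverings of the two parts taken one
      -- after the other.
      e≤ : e ≤ e₁ + e₂
      e≤ = ≤-from (outerMeasure-glb outer₁ λ {v₁} c₁ →
          ≤-from (outerMeasure-glb outer₂ λ {v₂} c₂ →
            ≤-from (outerMeasure-≤ outer (covered-⊆ split (covered-∪ c₁ c₂)))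
              (solve 3 (λ e u v → v :- (e :- u) := u :+ v :- e) ≈-refl e v₁ v₂))
            (solve 3 (λ e u v → u :- (e :- v) := v :- (e :- u)) ≈-refl e v₁ e₂))
        (solve 3 (λ e u v → u :+ v :- e := u :- (e :- v)) ≈-refl e e₁ e₂)
        where
        split : E ⊆ (E ∩ A) ∪ (E ∩ ∁ A)
        split {x} x∈E with halfOpen? a b x
        ... | yes x∈A = inj₁ (x∈E , x∈A)
        ... | no  x∉A = inj₂ (x∈E , x∉A)

      -- A covering of E is cut at a and at b.  The middle piece covers E ∩ A up to
      -- the point a, the outer pieces cover E ∩ ∁ A up to the point b, and each of
      -- these points is covered by an interval of length ε / 2.
      ≤e : e₁ + e₂ ≤ e
      ≤e = outerMeasure-glb outer λ {v} c → ≤-approx λ ε 0<ε →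
        let h , 0<h , h+h≈ε = half 0<ε
            u₁ , c-left , c-right = covered-cut a c
            u₂ , c-middle , c-far = covered-cut b c-right
            e₁≤ = outerMeasure-≤ outer₁
              (covered-⊆ inside (covered-∪ (covered-point a h 0<h) c-middle))
            e₂≤ = outerMeasure-≤ outer₂
              (covered-⊆ outside (covered-∪ c-left (covered-∪ (covered-point b h 0<h) c-far)))
        in ≤-respʳ (≈-trans
             (solve 4 (λ v u u′ h → h :+ u′ :+ (u :+ (h :+ (v :- u :- u′))) := v :+ (h :+ h))
               ≈-refl v u₁ u₂ h)
             (+-congˡ h+h≈ε))
             (+-mono-≤ e₁≤ e₂≤)
        where
        inside : E ∩ A ⊆ (_≈ a) ∪ ((E ∩ (a <_)) ∩ (_< b))
        inside {x} (x∈E , a≤x , x<b) with x ≟ a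
        ... | yes x≈a = inj₁ x≈a
        ... | no  x≉a = inj₂ ((x∈E , a≤x , λ a≈x → x≉a (≈-sym a≈x)) , x<b)

        outside : E ∩ ∁ A ⊆ (E ∩ (_< a)) ∪ ((_≈ b) ∪ ((E ∩ (a <_)) ∩ (b <_)))
        outside {x} (x∈E , x∉A) with a ≤? x | x ≤? b
        ... | no a≰x  | _ = inj₁ (x∈E , ≰⇒> a≰x)
        ... | yes a≤x | yes x≤b = inj₂ (inj₁ (antisym x≤b (≮⇒≥ λ x<b → x∉A (a≤x , x<b))))
        ... | yes a≤x | no x≰b = inj₂ (inj₂ ((x∈E , ≤-<-trans a≤b (≰⇒> x≰b)) , ≰⇒> x≰b))

  module _ {a b : ℝ} (Φ : Func [ a , b ]ℝ ℝ≥0) {I : ℝ} (isIntegral : IsLebesgueIntegral Φ I) where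

    simpleIntegral-≤ : (s : SimpleFunction (Interval a b)) →
      (∀ t (t∈ : Interval a b t) → simpleValue s t ≤ apply Φ t t∈) → simpleIntegral s ≤ I
    simpleIntegral-≤ s s≤Φ = proj₁ (IsLebesgueIntegral.isSupremum isIntegral) (s , s≤Φ , ≈-refl)

    0≤integral : 0# ≤ I
    0≤integral = simpleIntegral-≤ [] λ t t∈ → proj₂ (Func.to Φ (t , t∈))

    module _ {J : Set} (m r : J → ℝ) (m≥0 : ∀ j → 0# ≤ m j) where

      -- The indicator of [a, r j) with coefficient m j.
      step : ∀ j → Interval a b (r j) → WeightedIndicator (Interval a b)
      step j (a≤r , r≤b) = record
        { coefficient   = m j
        ; coefficient≥0 = m≥0 j
        ; set           = HalfOpen a (r j)
        ; set⊆X         = λ (a≤t , t<r) → a≤t , ≤-trans (proj₁ t<r) r≤b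
        ; set?          = halfOpen? a (r j)
        ; isMeasurable  = halfOpen-isMeasurable a≤r
        ; measure       = r j - a
        ; isMeasure     = halfOpen-isOuterMeasure a≤r
        }

      -- The simple function t ↦ ∑ {m j : r j > t} on [a, b].
      steps : ∀ {js} → All (Interval a b ∘ r) js → SimpleFunction (Interval a b)
      steps {[]}     []         = []
      steps {j ∷ _} (r∈ ∷ rs∈) = step j r∈ ∷ steps rs∈

      steps-integral : ∀ {js} (rs∈ : All (Interval a b ∘ r) js) →
        simpleIntegral (steps rs∈) ≈ ∑ js (λ j → m j * (r j - a))
      steps-integral []         = ≈-refl
      steps-integral (_ ∷ rs∈) = +-congˡ (steps-integral rs∈)

      steps-value : ∀ {js} (rs∈ : All (Interval a b ∘ r) js) {t} → a ≤ t →
        simpleValue (steps rs∈) t ≈ ∑ (filter (λ j → t <? r j) js) m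
      steps-value []                 a≤t = ≈-refl
      steps-value {j ∷ _} (_ ∷ rs∈) {t} a≤t with a ≤? t | t <? r j
      ... | no a≰t | _     = contradiction a≤t a≰t
      ... | yes _  | yes _ = +-congˡ (steps-value rs∈ a≤t)
      ... | yes _  | no _  = ≈-trans (+-identityˡ _) (steps-value rs∈ a≤t)

      -- If the tail t ↦ ∑ {m j : r j > t} of a finite measure m is at most Φ, then the
      -- m-integral of r - a is at most the integral of Φ.
      layer-cake : ∀ {js} → All (Interval a b ∘ r) js →
        (∀ t (t∈ : Interval a b t) → ∑ (filter (λ j → t <? r j) js) m ≤ apply Φ t t∈) →
        ∑ js (λ j → m j * (r j - a)) ≤ I
      layer-cake rs∈ tail≤Φ = ≤-respˡ (steps-integral rs∈) (simpleIntegral-≤ (steps rs∈) λ t t∈ →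
        ≤-respˡ (≈-sym (steps-value rs∈ (proj₁ t∈))) (tail≤Φ t t∈))

-- Distances inside connected vertex sets

module _ (G : ConnectedGraph n) where
  open ConnectedGraph G

  -- Walks of the subgraph induced by S.
  WalkIn : List (Fin n) → ℕ → Fin n → Fin n → Set
  WalkIn S = Walk (λ u v → Adj u v × u ∈ S × v ∈ S)

  -- S with every occurrence of x removed.
  _without_ : List (Fin n) → Fin n → List (Fin n)
  S without x = filter (λ z → ¬? (z Fin.≟ x)) S

  -- A walk from u to y in S either avoids x entirely, or has a last visit to x, after
  -- which it continues from a neighbour z of x without meeting x again.
  last-visit : ∀ {S k u y} x → WalkIn S k u y → u ∈ S → y ≢ x →
    (u ≢ x × ∃ λ j → WalkIn (S without x) j u y) ⊎
    (∃ λ z → Adj x z × z ∈ S without x × ∃ λ j → WalkIn (S without x) j z y)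
  last-visit x [] u∈ y≢x = inj₁ (y≢x , 0 , [])
  last-visit {u = u} x ((adj , u∈ , z∈) ∷ p) _ y≢x with last-visit x p z∈ y≢x
  ... | inj₂ found = inj₂ found
  ... | inj₁ (z≢x , _ , q) with u Fin.≟ x
  ...   | yes refl = inj₂ (_ , adj , ∈-filter⁺ _ z∈ z≢x , _ , q)
  ...   | no  u≢x  = inj₁ (u≢x , _ , (adj , ∈-filter⁺ _ u∈ u≢x , ∈-filter⁺ _ z∈ z≢x) ∷ q)

  -- Loop erasure, by induction on a bound m for |S|: after the last visit to its
  -- starting point x, the walk stays in S without x.
  shortcut : ∀ m {S k x y} → length S ℕ.≤ m → x ∈ S → WalkIn S k x y →
    ∃ λ j → j ℕ.< length S × Walk Adj j x y
  shortcut ℕ.zero    {[]} _ () _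
  shortcut (ℕ.suc m) {S} {x = x} {y} |S|≤1+m x∈S p with y Fin.≟ x
  ... | yes refl = 0 , nonempty x∈S , []
    where
    nonempty : ∀ {S : List (Fin n)} {x} → x ∈ S → 0 ℕ.< length S
    nonempty (here _)  = ℕ.z<s
    nonempty (there _) = ℕ.z<s
  ... | no y≢x with last-visit x p x∈S y≢x
  ...   | inj₁ (x≢x , _) = contradiction refl x≢x
  ...   | inj₂ (z , adj , z∈ , _ , q) =
    let smaller = filter-notAll (λ z → ¬? (z Fin.≟ x)) S (Any.map (λ { refl x≢x → x≢x refl }) x∈S)
        j , j< , r = shortcut m (ℕ.≤-pred (ℕ.≤-trans smaller |S|≤1+m)) z∈ q
    in ℕ.suc j , ℕ.≤-trans (ℕ.s≤s j<) smaller , adj ∷ r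

  dist-≤ : ∀ {k x y} → Walk Adj k x y → dist x y ℕ.≤ k
  dist-≤ {x = x} {y} = proj₂ (proj₂ (shortest x y))

  dist-self : ∀ x → dist x x ≡ 0
  dist-self x = ℕ.n≤0⇒n≡0 (dist-≤ [])

  dist-distinct : ∀ {x y} → x ≢ y → 1 ℕ.≤ dist x y
  dist-distinct {x} {y} x≢y with shortest x y
  ... | ℕ.zero  , [] , _ = contradiction refl x≢y
  ... | ℕ.suc _ , _  , _ = ℕ.s≤s ℕ.z≤n

  dist-connected : ∀ {S x y} → InducesConnected S → x ∈ S → y ∈ S → dist x y ℕ.≤ length S ∸ 1
  dist-connected {S} conn x∈S y∈S =
    let _ , p = conn x∈S y∈S
        j , j< , q = shortcut (length S) ℕ.≤-refl x∈S p
    in ℕ.≤-trans (dist-≤ q) (ℕ.∸-monoˡ-≤ 1 j<)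

  dist-diam : ∀ {S x y} → x ∈ S → y ∈ S → dist x y ℕ.≤ diam S
  dist-diam x∈S y∈S = All.lookup (xs≤max 0 _) (∈-map⁺ _ (∈-cartesianProduct⁺ x∈S y∈S))

  diam-connected : ∀ {S} → InducesConnected S → diam S ℕ.≤ length S ∸ 1
  diam-connected {S} conn = max≤v⁺ ℕ.z≤n (All.map⁺ (All.tabulate λ xy∈ →
    let x∈S , y∈S = ∈-cartesianProduct⁻ S S xy∈ in dist-connected conn x∈S y∈S))

  edge-adj : ∀ {x y} → (x , y) ∈ edges → Adj x y
  edge-adj xy∈ = proj₂ (proj₂ (∈-filter⁻ _ {xs = cartesianProduct (allFin n) (allFin n)} xy∈))

  edge-distinct : ∀ {x y} → (x , y) ∈ edges → x ≢ y
  edge-distinct xy∈ x≡y = irreflexive x≡y (edge-adj xy∈)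

-- Leaves and clusters of trees

module _ {A : Set} where

  -- The two children of every internal node have no leaf in common.
  Separated : Tree A → Set
  Separated (leaf _)   = ⊤
  Separated (node l r) = Disjoint (leaves l) (leaves r) × Separated l × Separated r

  unique-++⁻ : ∀ xs {ys : List A} → Unique (xs ++ ys) → Disjoint xs ys × Unique xs × Unique ys
  unique-++⁻ []       u            = (λ ()) , [] , u
  unique-++⁻ (x ∷ xs) {ys} (x≢ ∷ u) = let d , uˡ , uʳ = unique-++⁻ xs u in
    disjoint d , All.++⁻ˡ xs x≢ ∷ uˡ , uʳ
    where
    disjoint : Disjoint xs ys → Disjoint (x ∷ xs) ys
    disjoint d (here refl , v∈ys) = All.lookup (All.++⁻ʳ xs x≢) v∈ys refl
    disjoint d (there v∈xs , v∈ys) = d (v∈xs , v∈ys)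

  separated : ∀ t → Unique (leaves t) → Separated t
  separated (leaf _)   _ = _
  separated (node l r) u = let d , uˡ , uʳ = unique-++⁻ (leaves l) u in
    d , separated l uˡ , separated r uʳ

  some-leaf : (t : Tree A) → ∃ λ x → x ∈ leaves t
  some-leaf (leaf x)   = x , here refl
  some-leaf (node l r) = let x , x∈ = some-leaf l in x , ∈-++⁺ˡ x∈

  children-disjoint : ∀ t → Separated t →
    All (λ (l , r) → Disjoint (leaves l) (leaves r)) (internalNodes t)
  children-disjoint (leaf _)   _              = []
  children-disjoint (node l r) (d , sˡ , sʳ) =
    d ∷ All.++⁺ (children-disjoint l sˡ) (children-disjoint r sʳ)

  All-clusters : ∀ {P : List A → Set} t → All P (clusters t) → All (P ∘ cluster) (internalNodes t)
  All-clusters (leaf _)   _        = []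
  All-clusters (node l r) (p ∷ ps) =
    p ∷ All.++⁺ (All-clusters l (All.++⁻ˡ (clusters l) ps)) (All-clusters r (All.++⁻ʳ (clusters l) ps))

  cluster-length : ∀ (t : Tree A) → All (λ S → length (cluster S) ℕ.≤ length (leaves t)) (internalNodes t)
  cluster-length (leaf _)   = []
  cluster-length (node l r) = ℕ.≤-refl ∷ All.++⁺
    (All.map (λ le → ℕ.≤-trans le (length-++-≤ˡ (leaves l))) (cluster-length l))
    (All.map (λ le → ℕ.≤-trans le (length-++-≤ʳ (leaves r) {leaves l})) (cluster-length r))

-- An edge crosses an internal node if its endpoints lie below different children.
Crosses : InternalNode (Fin n) → Fin n × Fin n → Set
Crosses (l , r) (x , y) = (x ∈ leaves l × y ∈ leaves r) ⊎ (x ∈ leaves r × y ∈ leaves l)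

-- The decision has the same form as the one in the definition of b, so that the two
-- agree definitionally.
crosses? : (S : InternalNode (Fin n)) (e : Fin n × Fin n) → Dec (Crosses S e)
crosses? (l , r) (x , y) = ((x ∈ₗ? leaves l) ×-dec (y ∈ₗ? leaves r))
                     ⊎-dec ((x ∈ₗ? leaves r) ×-dec (y ∈ₗ? leaves l))

if-dec : ∀ {P A : Set} (P? : Dec P) (x y : A) →
  (P × (if does P? then x else y) ≡ x) ⊎ (if does P? then x else y) ≡ y
if-dec (yes p) x y = inj₁ (p , refl)
if-dec (no _)  x y = inj₂ refl

lca-∈ : ∀ (t : Tree (Fin n)) {x y} → x ∈ leaves t → y ∈ leaves t →
  let C = lcaCluster t x y in C ∈ clusters t × x ∈ C × y ∈ C
lca-∈ (leaf _)   x∈ y∈ = here refl , x∈ , y∈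
lca-∈ t@(node l r) {x} {y} x∈ y∈
  with if-dec ((x ∈ₗ? leaves l) ×-dec (y ∈ₗ? leaves l)) (lcaCluster l x y)
              (if does ((x ∈ₗ? leaves r) ×-dec (y ∈ₗ? leaves r)) then lcaCluster r x y else leaves t)
... | inj₁ ((x∈l , y∈l) , eq) rewrite eq =
  let C∈ , ∈C = lca-∈ l x∈l y∈l in there (∈-++⁺ˡ C∈) , ∈C
... | inj₂ eq rewrite eq
  with if-dec ((x ∈ₗ? leaves r) ×-dec (y ∈ₗ? leaves r)) (lcaCluster r x y) (leaves t)
...   | inj₁ ((x∈r , y∈r) , eq′) rewrite eq′ =
  let C∈ , ∈C = lca-∈ r x∈r y∈r in there (∈-++⁺ʳ (clusters l) C∈) , ∈C
...   | inj₂ eq′ rewrite eq′ = here refl , x∈ , y∈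

module Hierarchies (T : Hierarchy n) where
  open Hierarchy T

  leaf-∈ : ∀ x → x ∈ leaves tree
  leaf-∈ x = ∈-resp-↭ (↭-sym leaves-↭) (∈-allFin x)

  tree-separated : Separated tree
  tree-separated = separated tree
    (Permutation.Unique-resp-↭ (≡.setoid (Fin n)) (↭⇒↭ₛ (↭-sym leaves-↭)) (allFin⁺ n))

  length-leaves : length (leaves tree) ≡ n
  length-leaves = ≡.trans (↭-length leaves-↭) (length-tabulate id)

-- The cost as a sum over internal nodes

module Sums (R : CompleteOrderedField) where
  open CompleteOrderedField R
  open OrderedField R
  open Optimisation R

  module _ {A : Set} where

    ∑-cong : ∀ xs {f g : A → ℝ} → (∀ {x} → x ∈ xs → f x ≈ g x) → ∑ xs f ≈ ∑ xs g
    ∑-cong []       eq = ≈-refl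
    ∑-cong (x ∷ xs) eq = +-cong (eq (here refl)) (∑-cong xs (eq ∘ there))

    ∑-mono : ∀ xs {f g : A → ℝ} → (∀ {x} → x ∈ xs → f x ≤ g x) → ∑ xs f ≤ ∑ xs g
    ∑-mono []       le = ≤-refl
    ∑-mono (x ∷ xs) le = +-mono-≤ (le (here refl)) (∑-mono xs (le ∘ there))

    0≤∑ : ∀ xs {f : A → ℝ} → (∀ {x} → x ∈ xs → 0# ≤ f x) → 0# ≤ ∑ xs f
    0≤∑ []       f≥0 = ≤-refl
    0≤∑ (x ∷ xs) f≥0 = 0≤+ (f≥0 (here refl)) (0≤∑ xs (f≥0 ∘ there))

    ∑-++ : ∀ xs ys {f : A → ℝ} → ∑ (xs ++ ys) f ≈ ∑ xs f + ∑ ys f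
    ∑-++ []       ys     = ≈-sym (+-identityˡ _)
    ∑-++ (x ∷ xs) ys {f} = ≈-trans (+-congˡ (∑-++ xs ys))
      (solve 3 (λ a b c → a :+ (b :+ c) := a :+ b :+ c) ≈-refl (f x) (∑ xs f) (∑ ys f))

    ∑-0 : ∀ (xs : List A) → ∑ xs (λ _ → 0#) ≈ 0#
    ∑-0 []       = ≈-refl
    ∑-0 (_ ∷ xs) = ≈-trans (+-identityˡ _) (∑-0 xs)

    ∑-+ : ∀ xs (f g : A → ℝ) → ∑ xs f + ∑ xs g ≈ ∑ xs (λ x → f x + g x)
    ∑-+ []       f g = +-identityˡ 0#
    ∑-+ (x ∷ xs) f g = ≈-trans
      (solve 4 (λ a b c d → (a :+ b) :+ (c :+ d) := (a :+ c) :+ (b :+ d)) ≈-refl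
        (f x) (∑ xs f) (g x) (∑ xs g))
      (+-congˡ (∑-+ xs f g))

    *-∑ : ∀ c xs (f : A → ℝ) → c * ∑ xs f ≈ ∑ xs (λ x → c * f x)
    *-∑ c []       f = zeroʳ c
    *-∑ c (x ∷ xs) f = ≈-trans (distribˡ c _ _) (+-congˡ (*-∑ c xs f))

  ∑-swap : ∀ {A B : Set} xs ys (f : A → B → ℝ) →
    ∑ xs (λ x → ∑ ys (f x)) ≈ ∑ ys (λ y → ∑ xs (λ x → f x y))
  ∑-swap []       ys f = ≈-sym (∑-0 ys)
  ∑-swap (x ∷ xs) ys f = ≈-trans (+-congˡ (∑-swap xs ys f)) (∑-+ ys (f x) _)

  ∑-filter : ∀ {a p} {A : Set a} {P : Pred A p} (P? : Decidable P) (f : A → ℝ) xs →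
    ∑ (filter P? xs) f ≈ ∑ xs (λ x → if does (P? x) then f x else 0#)
  ∑-filter P? f []       = ≈-refl
  ∑-filter P? f (x ∷ xs) with P? x
  ... | yes _ = +-congˡ (∑-filter P? f xs)
  ... | no  _ = ≈-trans (∑-filter P? f xs) (≈-sym (+-identityˡ _))

  if-*-comm : ∀ c {x y} → x * (if c then y else 0#) ≈ y * (if c then x else 0#)
  if-*-comm true  = *-comm _ _
  if-*-comm false = ≈-trans (zeroʳ _) (≈-sym (zeroʳ _))

  -- The contribution f(S) of a node S that the pair e crosses.
  crossing : (List (Fin n) → ℝ) → Fin n × Fin n → InternalNode (Fin n) → ℝ
  crossing f e S = if does (crosses? S e) then f (cluster S) else 0#

  crossing-0 : ∀ (t : Tree (Fin n)) f {x y} → ¬ (x ∈ leaves t × y ∈ leaves t) →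
    ∑ (internalNodes t) (crossing f (x , y)) ≈ 0#
  crossing-0 (leaf _)   f ∉t = ≈-refl
  crossing-0 (node l r) f {x} {y} ∉t
    rewrite dec-false (crosses? (l , r) (x , y))
      (λ { (inj₁ (x∈l , y∈r)) → ∉t (∈-++⁺ˡ x∈l , ∈-++⁺ʳ _ y∈r)
         ; (inj₂ (x∈r , y∈l)) → ∉t (∈-++⁺ʳ _ x∈r , ∈-++⁺ˡ y∈l) }) = begin
    0# + ∑ (internalNodes l ++ internalNodes r) (crossing f (x , y)) ≈⟨ +-identityˡ _ ⟩
    ∑ (internalNodes l ++ internalNodes r) (crossing f (x , y))
      ≈⟨ ∑-++ (internalNodes l) (internalNodes r) ⟩
    ∑ (internalNodes l) (crossing f (x , y)) + ∑ (internalNodes r) (crossing f (x , y))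
      ≈⟨ +-cong (crossing-0 l f λ (x∈ , y∈) → ∉t (∈-++⁺ˡ x∈ , ∈-++⁺ˡ y∈))
                (crossing-0 r f λ (x∈ , y∈) → ∉t (∈-++⁺ʳ _ x∈ , ∈-++⁺ʳ _ y∈)) ⟩
    0# + 0# ≈⟨ +-identityˡ 0# ⟩
    0# ∎
    where open ≈-Reasoning

  -- Distinct leaves x and y cross exactly one node, their lowest common ancestor.
  crossing-lca : ∀ (t : Tree (Fin n)) f {x y} → Separated t → x ∈ leaves t → y ∈ leaves t → x ≢ y →
    ∑ (internalNodes t) (crossing f (x , y)) ≈ f (lcaCluster t x y)
  crossing-lca (leaf _)   f _ (here refl) (here refl) x≢y = contradiction refl x≢y
  crossing-lca (node l r) f {x} {y} (disjoint , sepˡ , sepʳ) x∈ y∈ x≢y =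
    ≈-trans (+-congˡ (∑-++ (internalNodes l) (internalNodes r)))
      (split (∈-++⁻ (leaves l) x∈) (∈-++⁻ (leaves l) y∈))
    where
    ∑ˡ = ∑ (internalNodes l) (crossing f (x , y))
    ∑ʳ = ∑ (internalNodes r) (crossing f (x , y))

    split : x ∈ leaves l ⊎ x ∈ leaves r → y ∈ leaves l ⊎ y ∈ leaves r →
      crossing f (x , y) (l , r) + (∑ˡ + ∑ʳ) ≈ f (lcaCluster (node l r) x y)
    split (inj₁ x∈l) (inj₁ y∈l)
      rewrite dec-true (x ∈ₗ? leaves l) x∈l | dec-true (y ∈ₗ? leaves l) y∈l
            | dec-false (x ∈ₗ? leaves r) (λ x∈r → disjoint (x∈l , x∈r))
            | dec-false (y ∈ₗ? leaves r) (λ y∈r → disjoint (y∈l , y∈r)) =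
      ≈-trans (+-identityˡ _) (≈-trans
        (+-cong (crossing-lca l f sepˡ x∈l y∈l x≢y)
                (crossing-0 r f λ (x∈r , _) → disjoint (x∈l , x∈r)))
        (+-identityʳ _))
    split (inj₂ x∈r) (inj₂ y∈r)
      rewrite dec-true (x ∈ₗ? leaves r) x∈r | dec-true (y ∈ₗ? leaves r) y∈r
            | dec-false (x ∈ₗ? leaves l) (λ x∈l → disjoint (x∈l , x∈r))
            | dec-false (y ∈ₗ? leaves l) (λ y∈l → disjoint (y∈l , y∈r)) =
      ≈-trans (+-identityˡ _) (≈-trans
        (+-cong (crossing-0 l f λ (x∈l , _) → disjoint (x∈l , x∈r))
                (crossing-lca r f sepʳ x∈r y∈r x≢y))
        (+-identityˡ _))
    split (inj₁ x∈l) (inj₂ y∈r)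
      rewrite dec-true (x ∈ₗ? leaves l) x∈l | dec-true (y ∈ₗ? leaves r) y∈r
            | dec-false (x ∈ₗ? leaves r) (λ x∈r → disjoint (x∈l , x∈r))
            | dec-false (y ∈ₗ? leaves l) (λ y∈l → disjoint (y∈l , y∈r)) =
      ≈-trans (+-congˡ (≈-trans
        (+-cong (crossing-0 l f λ (_ , y∈l) → disjoint (y∈l , y∈r))
                (crossing-0 r f λ (x∈r , _) → disjoint (x∈l , x∈r)))
        (+-identityʳ _))) (+-identityʳ _)
    split (inj₂ x∈r) (inj₁ y∈l)
      rewrite dec-true (x ∈ₗ? leaves r) x∈r | dec-true (y ∈ₗ? leaves l) y∈l
            | dec-false (x ∈ₗ? leaves l) (λ x∈l → disjoint (x∈l , x∈r))
            | dec-false (y ∈ₗ? leaves r) (λ y∈r → disjoint (y∈l , y∈r)) =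
      ≈-trans (+-congˡ (≈-trans
        (+-cong (crossing-0 l f λ (x∈l , _) → disjoint (x∈l , x∈r))
                (crossing-0 r f λ (_ , y∈r) → disjoint (y∈l , y∈r)))
        (+-identityʳ _))) (+-identityʳ _)

  module _ (G : ConnectedGraph n) (w : Weights G) where
    open ConnectedGraph G
    open Weights w using (weight)

    b-as-sum : ∀ S → b G w S ≈ ∑ edges (λ e → if does (crosses? S e) then weight (proj₁ e) (proj₂ e) else 0#)
    b-as-sum (l , r) = ∑-filter (crosses? (l , r)) (λ (x , y) → weight x y) edges

    0≤b : ∀ S → 0# ≤ b G w S
    0≤b (l , r) = 0≤∑ (filter (crosses? (l , r)) edges) λ e∈ →
      proj₁ (Weights.positive w (edge-adj G (proj₁ (∈-filter⁻ (crosses? (l , r)) e∈))))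

    0≤a-mass : ∀ S → 0# ≤ a-mass G w S
    0≤a-mass S = *-nonNegative (0≤fromℕ (Δ G w S)) (0≤b S)

    module _ (T : Hierarchy n) where
      open Hierarchy T
      open Hierarchies T

      -- The edge sum of w(x,y) f(C(x,y)), grouped by lowest common ancestors.
      cost-lca : ∀ f u → (∀ {x y} → x ≢ y → u x y ≈ f (lcaCluster tree x y)) →
        cost G w u ≈ ∑ (internalNodes tree) (λ S → f (cluster S) * b G w S)
      cost-lca f u u≈f = begin
        ∑ edges (λ (x , y) → weight x y * u x y)
          ≈⟨ ∑-cong edges (λ {(x , y)} e∈ → let x≢y = edge-distinct G e∈ in *-congˡ (≈-trans (u≈f x≢y)
               (≈-sym (crossing-lca tree f tree-separated (leaf-∈ x) (leaf-∈ y) x≢y)))) ⟩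
        ∑ edges (λ e → W e * ∑ nodes (crossing f e))
          ≈⟨ ∑-cong edges (λ {e} _ → *-∑ (W e) nodes (crossing f e)) ⟩
        ∑ edges (λ e → ∑ nodes (λ S → W e * crossing f e S))
          ≈⟨ ∑-swap edges nodes (λ e S → W e * crossing f e S) ⟩
        ∑ nodes (λ S → ∑ edges (λ e → W e * crossing f e S))
          ≈⟨ ∑-cong nodes (λ {S} _ → ∑-cong edges λ {e} _ → if-*-comm (does (crosses? S e))) ⟩
        ∑ nodes (λ S → ∑ edges (λ e → f (cluster S) * (if does (crosses? S e) then W e else 0#)))
          ≈⟨ ∑-cong nodes (λ {S} _ → *-∑ (f (cluster S)) edges _) ⟨
        ∑ nodes (λ S → f (cluster S) * ∑ edges (λ e → if does (crosses? S e) then W e else 0#))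
          ≈⟨ ∑-cong nodes (λ {S} _ → *-congˡ (b-as-sum S)) ⟨
        ∑ nodes (λ S → f (cluster S) * b G w S) ∎
        where
        open ≈-Reasoning
        nodes = internalNodes tree
        W : Fin _ × Fin _ → ℝ
        W (x , y) = weight x y

-- The cardinality cost of a connected hierarchy

module CardinalityCost (R : CompleteOrderedField) (G : ConnectedGraph n) (T : Hierarchy n)
  (connected : IsConnectedHierarchy G T) where
  open CompleteOrderedField R
  open LebesgueIntegral R
  open Optimisation R
  open OrderedField R
  open Measure R
  open Sums R
  open ConnectedGraph G using (dist; diam)
  open Hierarchy T
  open Hierarchies T

  private
    nodes = internalNodes tree

  dist≤height : ∀ x y → dist x y ℕ.≤ height x y
  dist≤height x y with x Fin.≟ y
  ... | yes refl = ℕ.≤-reflexive (dist-self G x)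
  ... | no _ = let C∈ , x∈ , y∈ = lca-∈ tree (leaf-∈ x) (leaf-∈ y) in
    dist-connected G (All.lookup connected C∈) x∈ y∈

  height-distinct : ∀ {x y} → x ≢ y → height x y ≡ length (lcaCluster tree x y) ∸ 1
  height-distinct {x} {y} x≢y with x Fin.≟ y
  ... | yes x≡y = contradiction x≡y x≢y
  ... | no _    = refl

  module _ (w : Weights G) where

    private
      -- The real quantities attached to a node S; size S is |S| - 1.
      Δ⟨_⟩ size b⟨_⟩ a⟨_⟩ ρ⟨_⟩ : InternalNode (Fin n) → ℝ
      Δ⟨ S ⟩ = fromℕ (Δ G w S)
      size S = fromℕ (length (cluster S) ∸ 1)
      b⟨_⟩   = b G w
      a⟨_⟩   = a-mass G w
      ρ⟨_⟩   = ρ G w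
      F⟨T⟩   = F G w T

    module _ {S} (S∈ : S ∈ nodes) where

      1≤Δ : 1# ≤ Δ⟨ S ⟩
      1≤Δ = let x , x∈l = some-leaf (proj₁ S)
                y , y∈r = some-leaf (proj₂ S)
                disjoint = All.lookup (children-disjoint tree tree-separated) S∈
            in 1≤fromℕ (ℕ.≤-trans
                 (dist-distinct G λ x≡y →
                   disjoint (x∈l , ≡.subst (_∈ leaves (proj₂ S)) (≡.sym x≡y) y∈r))
                 (dist-diam G {cluster S} (∈-++⁺ˡ x∈l) (∈-++⁺ʳ (leaves (proj₁ S)) y∈r)))

      Δ≤size : Δ⟨ S ⟩ ≤ size S
      Δ≤size = fromℕ-mono (diam-connected G (All.lookup (All-clusters tree connected) S∈))

      Δ*ρ : Δ⟨ S ⟩ * ρ⟨ S ⟩ ≈ size S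
      Δ*ρ = begin
        Δ⟨ S ⟩ * (size S * Δ⟨ S ⟩ ⁻¹)
          ≈⟨ solve 3 (λ d s i → d :* (s :* i) := s :* (i :* d)) ≈-refl Δ⟨ S ⟩ (size S) (Δ⟨ S ⟩ ⁻¹) ⟩
        size S * (Δ⟨ S ⟩ ⁻¹ * Δ⟨ S ⟩)
          ≈⟨ *-congˡ (⁻¹-inverseˡ (1≤⇒≉0 1≤Δ)) ⟩
        size S * 1#
          ≈⟨ *-identityʳ _ ⟩
        size S ∎
        where open ≈-Reasoning

      ρ∈ : Interval 1# (fromℕ (n ∸ 1)) ρ⟨ S ⟩
      ρ∈ = 1≤ρ , ρ≤
        where
        0≤Δ⁻¹ : 0# ≤ Δ⟨ S ⟩ ⁻¹
        0≤Δ⁻¹ = 0≤⁻¹ (≤-trans 0≤1 1≤Δ) (1≤⇒≉0 1≤Δ)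

        1≤ρ : 1# ≤ ρ⟨ S ⟩
        1≤ρ = ≤-respˡ (⁻¹-inverseˡ (1≤⇒≉0 1≤Δ)) (≤-respʳ (*-comm _ _) (*-monoʳ-≤ 0≤Δ⁻¹ Δ≤size))

        ρ≤size : ρ⟨ S ⟩ ≤ size S
        ρ≤size = ≤-respˡ (*-identityʳ _) (≤-respʳ (≈-trans (*-comm _ _) Δ*ρ)
          (*-monoʳ-≤ (≤-trans 0≤1 1≤ρ) 1≤Δ))

        ρ≤ : ρ⟨ S ⟩ ≤ fromℕ (n ∸ 1)
        ρ≤ = ≤-trans ρ≤size (fromℕ-mono (ℕ.∸-monoˡ-≤ 1
          (ℕ.≤-trans (All.lookup (cluster-length tree) S∈) (ℕ.≤-reflexive length-leaves))))

    F≈∑a : F⟨T⟩ ≈ ∑ nodes a⟨_⟩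
    F≈∑a = cost-lca G w T (fromℕ ∘ diam) _ λ _ → ≈-refl

    -- The cardinality cost ∑ w(x,y) h(x,y) of T.
    heightCost : ℝ
    heightCost = cost G w (λ x y → fromℕ (height x y))

    heightCost≈∑aρ : heightCost ≈ ∑ nodes (λ S → a⟨ S ⟩ * ρ⟨ S ⟩)
    heightCost≈∑aρ = ≈-trans
      (cost-lca G w T (λ C → fromℕ (length C ∸ 1)) _ λ x≢y →
        Eq.reflexive (≡.cong fromℕ (height-distinct x≢y)))
      (∑-cong nodes λ {S} S∈ → ≈-trans (*-congʳ (≈-sym (Δ*ρ S∈)))
        (solve 3 (λ d r b → d :* r :* b := d :* b :* r) ≈-refl Δ⟨ S ⟩ ρ⟨ S ⟩ b⟨ S ⟩))

    0≤F : 0# ≤ F⟨T⟩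
    0≤F = ≤-respʳ (≈-sym F≈∑a) (0≤∑ nodes λ {S} _ → 0≤a-mass G w S)

    OPTcard≤heightCost : ∀ {c} → IsOPTcard G w c → c ≤ heightCost
    OPTcard≤heightCost (_ , lower) = lower (T , dist≤height , ≈-refl)

    module _ (Φ : Func [ 1# , fromℕ (n ∸ 1) ]ℝ ℝ≥0)
      (tail≤Φ : ∀ t (t∈ : Interval 1# (fromℕ (n ∸ 1)) t) →
        μ G w T (λ S → t <? ρ G w S) ≤ apply Φ t t∈)
      {I : ℝ} (isIntegral : IsLebesgueIntegral Φ I) where

      heightCost≤ : heightCost ≤ F⟨T⟩ * (1# + I)
      -- In the case F(T) = 0, which has to be separated because of the division by
      -- F(T), the bound ρ(S) ≤ n - 1 shows that the cardinality cost is 0 as well.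
      heightCost≤ with F⟨T⟩ ≟ 0#
      ... | yes F≈0 = begin
        heightCost                          ≈⟨ heightCost≈∑aρ ⟩
        ∑ nodes (λ S → a⟨ S ⟩ * ρ⟨ S ⟩)     ≤⟨ ∑-mono nodes (λ {S} S∈ →
          ≤-respʳ (*-comm _ _) (*-monoʳ-≤ (0≤a-mass G w S) (proj₂ (ρ∈ S∈)))) ⟩
        ∑ nodes (λ S → fromℕ (n ∸ 1) * a⟨ S ⟩) ≈⟨ *-∑ _ nodes a⟨_⟩ ⟨
        fromℕ (n ∸ 1) * ∑ nodes a⟨_⟩        ≈⟨ *-congˡ (≈-trans (≈-sym F≈∑a) F≈0) ⟩
        fromℕ (n ∸ 1) * 0#                  ≈⟨ ≈-trans (zeroʳ _) (≈-sym (zeroˡ _)) ⟩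
        0# * (1# + I)                       ≈⟨ *-congʳ F≈0 ⟨
        F⟨T⟩ * (1# + I)                     ∎
        where open ≤-Reasoning
      ... | no F≉0 = begin
        heightCost                           ≈⟨ heightCost≈∑aρ ⟩
        ∑ nodes (λ S → a⟨ S ⟩ * ρ⟨ S ⟩)      ≈⟨ ∑-cong nodes (λ {S} _ → aρ S) ⟩
        ∑ nodes (λ S → a⟨ S ⟩ + F⟨T⟩ * (m S * (ρ⟨ S ⟩ - 1#)))
                                             ≈⟨ ∑-+ nodes a⟨_⟩ _ ⟨
        ∑ nodes a⟨_⟩ + ∑ nodes (λ S → F⟨T⟩ * (m S * (ρ⟨ S ⟩ - 1#)))
                                             ≈⟨ +-cong F≈∑a (*-∑ F⟨T⟩ nodes _) ⟨
        F⟨T⟩ + F⟨T⟩ * ∑ nodes (λ S → m S * (ρ⟨ S ⟩ - 1#))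
                                             ≤⟨ +-monoʳ-≤ F⟨T⟩ (*-monoʳ-≤ 0≤F excess≤I) ⟩
        F⟨T⟩ + F⟨T⟩ * I                      ≈⟨ +-congʳ (*-identityʳ F⟨T⟩) ⟨
        F⟨T⟩ * 1# + F⟨T⟩ * I                 ≈⟨ distribˡ F⟨T⟩ 1# I ⟨
        F⟨T⟩ * (1# + I)                      ∎
        where
        open ≤-Reasoning
        -- The mass μ(S).
        m : InternalNode (Fin n) → ℝ
        m S = a⟨ S ⟩ * F⟨T⟩ ⁻¹

        excess≤I : ∑ nodes (λ S → m S * (ρ⟨ S ⟩ - 1#)) ≤ I
        excess≤I = layer-cake Φ isIntegral m ρ⟨_⟩
          (λ S → *-nonNegative (0≤a-mass G w S) (0≤⁻¹ 0≤F F≉0)) (All.tabulate ρ∈) tail≤Φ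

        aρ : ∀ S → a⟨ S ⟩ * ρ⟨ S ⟩ ≈ a⟨ S ⟩ + F⟨T⟩ * (m S * (ρ⟨ S ⟩ - 1#))
        aρ S = ≈-sym (begin-equality
          a + F⟨T⟩ * (a * F⟨T⟩ ⁻¹ * (r - 1#))       ≈⟨ +-congˡ (solve 5
            (λ f a i r o → f :* (a :* i :* (r :- o)) := (i :* f) :* (a :* r :- a :* o))
            ≈-refl F⟨T⟩ a (F⟨T⟩ ⁻¹) r 1#) ⟩
          a + (F⟨T⟩ ⁻¹ * F⟨T⟩) * (a * r - a * 1#)   ≈⟨ +-congˡ (*-cong (⁻¹-inverseˡ F≉0)
                                                        (+-congˡ (-‿cong (*-identityʳ a)))) ⟩
          a + 1# * (a * r - a)                      ≈⟨ +-congˡ (*-identityˡ _) ⟩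
          a + (a * r - a)                           ≈⟨ solve 2 (λ a p → a :+ (p :- a) := p) ≈-refl a (a * r) ⟩
          a * r                                     ∎)
          where
          a = a⟨ S ⟩
          r = ρ⟨ S ⟩

theorem18 : (R : CompleteOrderedField) →
    let open CompleteOrderedField R
        open LebesgueIntegral R
        open Optimisation R
    in
    {n : ℕ} → 2 ℕ.≤ n →
    (G : ConnectedGraph n) (w : Weights G) →
    (T : Hierarchy n) → IsConnectedHierarchy G T →
    (OPTfree : ℝ) → IsOPTfree G w OPTfree →
    (α : ℝ) → 1# ≤ α → F G w T ≤ α * OPTfree →
    (Φ : Func [ 1# , fromℕ (n ∸ 1) ]ℝ ℝ≥0) →
    (∀ t (t∈ : Interval 1# (fromℕ (n ∸ 1)) t) →
      μ G w T (λ S → t <? ρ G w S) ≤ apply Φ t t∈) →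
    (∫Φ : ℝ) → IsLebesgueIntegral Φ ∫Φ →
    (OPTcard : ℝ) → IsOPTcard G w OPTcard →
    OPTcard ≤ α * (1# + ∫Φ) * OPTfree
theorem18 R _ G w T connected OPTfree _ α _ F≤ Φ tail≤Φ ∫Φ isIntegral OPTcard isOPTcard = begin
  OPTcard                    ≤⟨ OPTcard≤heightCost w isOPTcard ⟩
  heightCost w               ≤⟨ heightCost≤ w Φ tail≤Φ isIntegral ⟩
  F G w T * (1# + ∫Φ)        ≈⟨ *-comm _ _ ⟩
  (1# + ∫Φ) * F G w T        ≤⟨ *-monoʳ-≤ (0≤+ 0≤1 (0≤integral Φ isIntegral)) F≤ ⟩
  (1# + ∫Φ) * (α * OPTfree)
    ≈⟨ solve 3 (λ s a o → s :* (a :* o) := a :* s :* o) ≈-refl (1# + ∫Φ) α OPTfree ⟩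
  α * (1# + ∫Φ) * OPTfree    ∎
  where
  open CompleteOrderedField R
  open Optimisation R
  open OrderedField R
  open Measure R
  open CardinalityCost R G T connected
  open ≤-Reasoning
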